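{- Let $\mathcal{P}$ be a hereditary property of partitions. Suppose that for every constant $c > 0$ there exists $N = N(c) \in \mathbb{N}$ such that $|\mathcal{P}_N| > c^N$. Then $\mathcal{P}$ contains the partition $H(\pi)$ for every $k \in \mathbb{N}$ and every permutation $\pi$ of $[k]$, and hence $$|\mathcal{P}_n| \ge |\mathcal{P}^{(1,2)}_n| \ge \sum_{k=0}^{\lfloor n/2 \rfloor} \binom{n}{2k} k! = n^{n/2 + o(n)}$$ for every $n \in \mathbb{N}$. This lower bound is best possible, and there is a unique hereditary property of partitions with this speed, i.e. there is exactly one hereditary property $\mathcal{Q}$ of partitions with $|\mathcal{Q}_n| = \sum_{k=0}^{\lfloor n/2 \rfloor} \binom{n}{2k} k!$ for every $n \in \mathbb{N}$.
   Context: A partition of $[n] = \{1,\ldots,n\}$ is an unordered collection of disjoint non-empty sets $\{A_1,\ldots,A_t\}$ with $A_1 \cup \cdots \cup A_t = [n]$. If $P = \{A_1,\ldots,A_t\}$ is a partition of $[n]$ and $S \subset [n]$ has elements $s_1 < \cdots < s_k$, the sub-partition of $P$ induced by $S$ is the partition of $[k]$ obtained from $\{B_1,\ldots,B_t\}$, where $i \in B_j$ if and only if $s_i \in A_j$, by deleting the empty classes. A property of partitions is a collection of partitions of the sets $[n]$; it is hereditary if it is closed under taking induced sub-partitions. $\mathcal{P}_n$ is the set of partitions of $[n]$ in $\mathcal{P}$, and the speed of $\mathcal{P}$ is the function $n \mapsto |\mathcal{P}_n|$. $\mathcal{P}^{(1,2)}$ denotes the set of partitions in $\mathcal{P}$ all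 of whose parts have size at most $2$. For a permutation $\pi$ of $[k]$, $H(\pi)$ is the partition $\{\{i,\pi(i)+k\} : i \in [k]\}$ of $[2k]$. -}

module Defs where

import Algebra.Definitions.RawSemiring
open import Data.Fin.Base as Fin using (Fin; _↑ˡ_; _↑ʳ_; splitAt)
open import Data.Fin.Permutation using (Permutation′; _⟨$⟩ʳ_; _⟨$⟩ˡ_; inverseʳ)
open import Data.Fin.Properties using
  (splitAt-↑ˡ; splitAt-↑ʳ; splitAt⁻¹-↑ˡ; splitAt⁻¹-↑ʳ; ↑ˡ-injective; ↑ʳ-injective)
open import Data.Fin.Subset using (Subset; _∈_; _∩_; _∪_; ⁅_⁆; ∣_∣; Nonempty; Empty)
open import Data.Fin.Subset.Properties using
  (nonempty?; x∈p∩q⁻; x∈p∩q⁺; x∈p∪q⁻; x∈p∪q⁺; x∈⁅x⁆; x∈⁅y⁆⇒x≡y)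
open import Data.Integer.Base using (+_)
open import Data.List.Base as List using (List; filter)
open import Data.List.Membership.Propositional using (find; lose)
import Data.List.Membership.Propositional.Properties as Mem
open import Data.List.Relation.Binary.BagAndSetEquality using (_∼[_]_; set; [_]-Equality)
open import Data.List.Relation.Unary.All as All using (All)
import Data.List.Relation.Unary.All.Properties as All
open import Data.List.Relation.Unary.AllPairs as AllPairs using (AllPairs)
import Data.List.Relation.Unary.AllPairs.Properties as AllPairs
open import Data.List.Relation.Unary.Any using (Any)
import Data.List.Relation.Unary.Any.Properties as Any
open import Data.Nat.Base as ℕ using (ℕ; suc; _+_; _*_; _≤_; NonZero; _!; ⌊_/2⌋)
open import Data.Nat.Combinatorics using (_C_)
open import Data.Nat.ListAction using (sum)
open import Data.Product.Base using (Σ; ∃; ∃₂; _×_; _,_; proj₁; proj₂)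
open import Data.Rational.Base as ℚ using (ℚ; Positive; _/_)
open import Data.Sum.Base using (_⊎_; inj₁; inj₂)
open import Data.Vec.Base using (tabulate; lookup)
open import Data.Vec.Properties using (lookup∘tabulate; []=⇒lookup; lookup⇒[]=)
open import Function.Base using (_∘_; _on_)
open import Function.Bundles using (_⇔_; Injection; Bijection; module Equivalence)
open import Function.Properties.Inverse using (↔⇒↣)
open import Level using (0ℓ)
open import Relation.Binary.Bundles using (Setoid)
open import Relation.Binary.Core using (_Preserves_⟶_)
import Relation.Binary.Construct.On as On
open import Relation.Binary.PropositionalEquality as ≡
  using (_≡_; _≢_; refl; sym; trans; cong; subst)
open import Relation.Nullary.Negation using (contradiction)

private
  variable
    k n : ℕ

Disjoint : Subset n → Subset n → Set
Disjoint A B = Empty (A ∩ B)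

-- The parts are listed in some order; _≈_ below forgets that order.
-- Since parts are non-empty and disjoint, the list has no repetitions.

record Partition (n : ℕ) : Set where
  field
    parts    : List (Subset n)
    nonempty : All Nonempty parts
    disjoint : AllPairs Disjoint parts
    covers   : ∀ i → Any (i ∈_) parts

open Partition public

PartitionSetoid : ℕ → Setoid 0ℓ 0ℓ
PartitionSetoid n = record
  { Carrier       = Partition n
  ; _≈_           = _∼[ set ]_ on parts
  ; isEquivalence = On.isEquivalence parts (Setoid.isEquivalence ([ set ]-Equality (Subset n)))
  }

infix 4 _≈_
_≈_ : Partition n → Partition n → Set
_≈_ {n} = Setoid._≈_ (PartitionSetoid n)

preimage : (Fin k → Fin n) → Subset n → Subset k
preimage s A = tabulate (lookup A ∘ s)

∈-preimage⁺ : (s : Fin k → Fin n) (A : Subset n) {i : Fin k} → s i ∈ A → i ∈ preimage s A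
∈-preimage⁺ s A {i} si∈A =
  lookup⇒[]= i _ (trans (lookup∘tabulate (lookup A ∘ s) i) ([]=⇒lookup si∈A))

∈-preimage⁻ : (s : Fin k → Fin n) (A : Subset n) {i : Fin k} → i ∈ preimage s A → s i ∈ A
∈-preimage⁻ s A {i} i∈ =
  lookup⇒[]= (s i) _ (trans (sym (lookup∘tabulate (lookup A ∘ s) i)) ([]=⇒lookup i∈))

-- A subset S ⊂ [n] with elements s₁ < ⋯ < s_k is given by the strictly
-- increasing enumeration s; monotonicity is only required in Hereditary.

induced : (Fin k → Fin n) → Partition n → Partition k
induced s P = record
  { parts    = filter nonempty? (List.map (preimage s) (parts P))
  ; nonempty = All.all-filter nonempty? (List.map (preimage s) (parts P))
  ; disjoint = AllPairs.filter⁺ nonempty? (AllPairs.map⁺ (AllPairs.map disj (disjoint P)))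
  ; covers   = λ i →
      let A , A∈P , si∈A = find (covers P (s i))
          i∈B            = ∈-preimage⁺ s A si∈A
      in lose (Mem.∈-filter⁺ nonempty? (Mem.∈-map⁺ (preimage s) A∈P) (i , i∈B)) i∈B
  }
  where
  disj : ∀ {A B} → Disjoint A B → Disjoint (preimage s A) (preimage s B)
  disj {A} {B} d (i , i∈) =
    let i∈A , i∈B = x∈p∩q⁻ _ _ i∈
    in d (s i , x∈p∩q⁺ (∈-preimage⁻ s A i∈A , ∈-preimage⁻ s B i∈B))

record Property : Set₁ where
  field
    Contains : Partition n → Set
    resp     : {P Q : Partition n} → P ≈ Q → Contains P → Contains Q

infix 4 _∋_
_∋_ : Property → Partition n → Set
𝒫 ∋ P = Property.Contains 𝒫 P

infix 4 _≐_
_≐_ : Property → Property → Set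
𝒫 ≐ 𝒬 = ∀ {n} (P : Partition n) → 𝒫 ∋ P ⇔ 𝒬 ∋ P

Hereditary : Property → Set
Hereditary 𝒫 = ∀ {k n} (P : Partition n) (s : Fin k → Fin n) →
  s Preserves Fin._<_ ⟶ Fin._<_ → 𝒫 ∋ P → 𝒫 ∋ induced s P

infix 8 _⁽¹²⁾
_⁽¹²⁾ : Property → Property
𝒫 ⁽¹²⁾ = record
  { Contains = λ P → 𝒫 ∋ P × All (λ A → ∣ A ∣ ≤ 2) (parts P)
  ; resp     = λ P≈Q (P∈𝒫 , small) →
      Property.resp 𝒫 P≈Q P∈𝒫 ,
      All.tabulate (λ A∈Q → All.lookup small (Equivalence.from P≈Q A∈Q))
  }

-- The set 𝒫ₙ; two elements are equal when they are the same partition.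

infixl 7 _at_
_at_ : Property → ℕ → Setoid 0ℓ 0ℓ
𝒫 at n = record
  { Carrier       = Σ (Partition n) (𝒫 ∋_)
  ; _≈_           = _≈_ on proj₁
  ; isEquivalence = On.isEquivalence proj₁ (Setoid.isEquivalence (PartitionSetoid n))
  }

-- Membership in a property need not be decidable, so the cardinality of
-- 𝒫ₙ is compared with numbers and with other cardinalities by maps.

infix 4 ∣_∣≥_ ∣_∣≡_ ∣_∣≥∣_∣

∣_∣≥_ : Setoid 0ℓ 0ℓ → ℕ → Set
∣ X ∣≥ m = Injection (≡.setoid (Fin m)) X

∣_∣≡_ : Setoid 0ℓ 0ℓ → ℕ → Set
∣ X ∣≡ m = Bijection (≡.setoid (Fin m)) X

∣_∣≥∣_∣ : Setoid 0ℓ 0ℓ → Setoid 0ℓ 0ℓ → Set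
∣ X ∣≥∣ Y ∣ = Injection Y X

open Algebra.Definitions.RawSemiring ℚ.+-*-rawSemiring public
  using () renaming (_^_ to _^ℚ_)

-- c ranges over the positive rationals; as these are cofinal in the
-- positive reals and c ↦ c ^ N is monotone, this amounts to all real c.

SuperExponential : Property → Set
SuperExponential 𝒫 = ∀ (c : ℚ) .{{_ : Positive c}} →
  ∃₂ λ N m → ∣ 𝒫 at N ∣≥ m × c ^ℚ N ℚ.< + m / 1

-- H π = {{i, π(i) + k} : i ∈ [k]}, with [2k] rendered as Fin (k + k).

module _ (π : Permutation′ k) where

  pair : Fin k → Subset (k + k)
  pair i = ⁅ i ↑ˡ k ⁆ ∪ ⁅ k ↑ʳ (π ⟨$⟩ʳ i) ⁆

  private
    ∈-pairˡ : ∀ i → i ↑ˡ k ∈ pair i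
    ∈-pairˡ i = x∈p∪q⁺ (inj₁ (x∈⁅x⁆ _))

    ∈-pairʳ : ∀ i → k ↑ʳ (π ⟨$⟩ʳ i) ∈ pair i
    ∈-pairʳ i = x∈p∪q⁺ (inj₂ (x∈⁅x⁆ _))

    ∈-pair⁻ : ∀ {x} i → x ∈ pair i → x ≡ i ↑ˡ k ⊎ x ≡ k ↑ʳ (π ⟨$⟩ʳ i)
    ∈-pair⁻ i x∈ with x∈p∪q⁻ _ _ x∈
    ... | inj₁ p = inj₁ (x∈⁅y⁆⇒x≡y _ p)
    ... | inj₂ p = inj₂ (x∈⁅y⁆⇒x≡y _ p)

    ↑ˡ≢↑ʳ : ∀ {i j : Fin k} → i ↑ˡ k ≢ k ↑ʳ j
    ↑ˡ≢↑ʳ {i} {j} eq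
      with () ← trans (sym (splitAt-↑ˡ k i k)) (trans (cong (splitAt k) eq) (splitAt-↑ʳ k k j))

    pair-unique : ∀ {x} i j → x ∈ pair i → x ∈ pair j → i ≡ j
    pair-unique i j x∈i x∈j with ∈-pair⁻ i x∈i | ∈-pair⁻ j x∈j
    ... | inj₁ p | inj₁ q = ↑ˡ-injective k i j (trans (sym p) q)
    ... | inj₁ p | inj₂ q = contradiction (trans (sym p) q) ↑ˡ≢↑ʳ
    ... | inj₂ p | inj₁ q = contradiction (trans (sym q) p) ↑ˡ≢↑ʳ
    ... | inj₂ p | inj₂ q =
      Injection.injective (↔⇒↣ π) (↑ʳ-injective k _ _ (trans (sym p) q))

    pair-covers : ∀ x → ∃ λ i → x ∈ pair i
    pair-covers x with splitAt k x in eq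
    ... | inj₁ i = i , subst (_∈ pair i) (splitAt⁻¹-↑ˡ eq) (∈-pairˡ i)
    ... | inj₂ j = π ⟨$⟩ˡ j ,
      subst (_∈ pair (π ⟨$⟩ˡ j))
            (trans (cong (k ↑ʳ_) (inverseʳ π)) (splitAt⁻¹-↑ʳ eq))
            (∈-pairʳ (π ⟨$⟩ˡ j))

  H : Partition (k + k)
  H = record
    { parts    = List.tabulate pair
    ; nonempty = All.tabulate⁺ (λ i → i ↑ˡ k , ∈-pairˡ i)
    ; disjoint = AllPairs.tabulate⁺ (λ {i} {j} i≢j (x , x∈) →
        let x∈i , x∈j = x∈p∩q⁻ _ _ x∈ in i≢j (pair-unique i j x∈i x∈j))
    ; covers   = λ x → let i , x∈ = pair-covers x in Any.tabulate⁺ i x∈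
    }

bound : ℕ → ℕ
bound n = sum (List.map (λ k → (n C (2 * k)) * k !) (List.upTo (suc ⌊ n /2⌋)))

-- f(n) = n^{n/2+o(n)}: for every ε = p/q > 0 and all large n,
--   n^{n/2-εn} ≤ f(n) ≤ n^{n/2+εn}.
-- Both inequalities are raised to the power 2q, and the negative power of
-- n is moved to the other side, to keep all exponents in ℕ.

IsHalfPower : (ℕ → ℕ) → Set
IsHalfPower f = ∀ p q .{{_ : NonZero p}} .{{_ : NonZero q}} → ∃ λ n₀ → ∀ n → n₀ ≤ n →
  n ℕ.^ (q * n) ≤ f n ℕ.^ (2 * q) * n ℕ.^ (2 * p * n) ×
  f n ℕ.^ (2 * q) ≤ n ℕ.^ (q * n + 2 * p * n)

{-# OPTIONS --safe #-}
module Submission where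

open import Defs
import Algebra.Properties.CommutativeMonoid.Sum
import Algebra.Properties.Semiring.Sum
open import Data.Bool.Base using (Bool; true; false; _∧_; if_then_else_)
import Data.Bool.Properties as Bool
open import Data.Empty using (⊥)
open import Data.Fin.Base as Fin using
  (Fin; zero; suc; toℕ; punchIn; _↑ˡ_; _↑ʳ_; splitAt; combine; remQuot; funToFin; finToFun; inject≤)
open import Data.Fin.Permutation as Perm using
  (Permutation′; Permutation; permutation; _⟨$⟩ʳ_; _⟨$⟩ˡ_; inverseʳ; inverseˡ; flip;
   insert; remove; insert-punchIn; insert-remove; ↔⇒≡; cast-id)
import Data.Fin.Properties as Fin
open import Data.Fin.Subset using (Subset; _∈_; ⁅_⁆; _∪_; ∣_∣)
open import Data.Fin.Subset.Properties using
  (_∈?_; nonempty?; x∈p∩q⁺; x∈p∪q⁻; x∈p∪q⁺; x∈⁅x⁆; x∈⁅y⁆⇒x≡y; ⊆-antisym; p⊆q⇒∣p∣≤∣q∣; ∣⁅x⁆∣≡1)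
open import Data.Integer.Base as ℤ using (+[1+_])
import Data.Integer.Properties as ℤ
open import Data.List.Base as List using (List; _∷_; applyUpTo)
open import Data.List.Membership.Propositional as List using (find; lose)
import Data.List.Membership.Propositional.Properties as Mem
open import Data.List.Properties using (map-upTo)
open import Data.List.Relation.Unary.All as All using (All)
open import Data.List.Relation.Unary.AllPairs using (AllPairs; _∷_)
open import Data.List.Relation.Unary.Any as Any using (Any; here; there)
import Data.List.Relation.Unary.Any.Properties as Any
open import Data.Nat.Base using
  (ℕ; zero; suc; _+_; _*_; _∸_; _^_; _!; _≤_; _<_; _≤ᵇ_; z≤n; s≤s; s<s; s≤s⁻¹; s<s⁻¹;
   ⌊_/2⌋; ⌈_/2⌉; NonZero; >-nonZero)
open import Data.Nat.Combinatorics using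
  (_C_; nCk≡nC[n∸k]; nCn≡1; nCk+nC[k+1]≡[n+1]C[k+1]; k>n⇒nCk≡0; nCk≡n!/k![n-k]!; k![n∸k]!∣n!)
open import Data.Nat.DivMod using (m/n*n≡m)
open import Data.Nat.ListAction renaming (sum to listSum)
import Data.Nat.Properties as ℕ
open import Data.Nat.Tactic.RingSolver using (solve-∀)
open import Data.Product using (∃; ∃₂; ∃!; _×_; _,_; proj₁; proj₂; uncurry; swap)
open import Data.Product.Function.NonDependent.Propositional using (_×-↔_)
open import Data.Rational.Base as ℚ using (ℚ; mkℚ; Positive; NonNegative; toℚᵘ; _/_)
import Data.Rational.Properties as ℚ
open import Data.Rational.Unnormalised.Base as ℚᵘ using (mkℚᵘ; *≤*; *<*)
import Data.Rational.Unnormalised.Properties as ℚᵘ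
open import Data.Sum.Base using (_⊎_; inj₁; inj₂; [_,_]′)
open import Data.Sum.Function.Propositional using (_⊎-↔_)
open import Data.Unit.Base using (⊤; tt)
open import Data.Vec.Base using ([]; _∷_)
open import Function.Base using (_∘_; id)
open import Function.Bundles using
  (_⇔_; mk⇔; _↔_; Equivalence; Inverse; Injection; Bijection)
open import Function.Construct.Composition using (_⇔-∘_; _↔-∘_)
open import Function.Construct.Identity using (↔-id)
open import Function.Construct.Symmetry using (⇔-sym)
open import Function.Definitions using (Injective)
open import Relation.Binary.Core using (_Preserves_⟶_)
open import Relation.Binary.Definitions using (tri<; tri≈; tri>)
open import Relation.Binary.PropositionalEquality as ≡
  using (_≡_; _≢_; _≗_; refl; sym; trans; cong; cong₂; subst)
open import Relation.Nullary using (¬_; Dec; yes; no; does; contradiction; ¬?)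
open import Relation.Nullary.Decidable using (dec-true; map′; _×-dec_; _→-dec_)
open import Relation.Unary using (Decidable)

module Sum = Algebra.Properties.CommutativeMonoid.Sum ℕ.+-0-commutativeMonoid
module SemiringSum = Algebra.Properties.Semiring.Sum ℕ.+-*-semiring
open Sum using (sum)
open Equivalence using (to; from)

-- Let M be the 0-1 matrix with a one at (i , j) when i is the minimum of
-- the part of j. If M contains the permutation matrix of π with one extra
-- last row and first column, then the rows used for π lie before the
-- columns used for π and are minima of distinct parts, so the partition
-- contains H π. The Marcus–Tardos theorem and Klazar's contraction argument
-- bound the number of n × n matrices avoiding a fixed permutation matrix by
-- c ^ n, hence a property that beats every c ^ n contains every H π.
--
-- The partitions induced by the H π are those into singletons and pairs such
-- that some threshold separates the two elements of every pair. Such a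
-- partition is given by the 2k paired elements and a permutation of [k], so
-- there are exactly bound n of them, and any hereditary property with that
-- speed contains, hence equals, this class.

-- A partition is determined by its minimum matrix, whose column `j` has a single one, in the row of
-- the minimum of the part of `j` (`minimumMatrix-injective`). For a fixed permutation, at most
-- `c ^ n` matrices of size `n` avoid it (`encodings`). A superexponential property therefore has a
-- partition whose matrix contains the pattern `extend π`, and `pattern⇒H` reads off a sub-partition
-- `H π`.
--
-- Avoiding matrices are controlled by contraction: a matrix is cut into square blocks, and the
-- matrix recording which blocks are non-zero still avoids the pattern (`hasPattern-contract`). Few
-- blocks in a block column can have many non-zero columns (`wide-blocks-few`), and likewise for
-- rows. All other non-zero blocks have at most `p * p` ones, so `ones-contract` gives a recursion
-- that, for blocks of size `β`, closes with a linear bound on the number of ones. The contraction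
-- then has only linearly many non-zero blocks, and a code of the contraction together with the
-- contents of those blocks is a code of the matrix (`encoding-*`). Other sizes are padded up to a
-- power of `β`.
--
-- For the speed, `𝓜` consists of the partitions induced by the `H π`, so it lies inside every
-- hereditary property containing them (`𝓜⊆`). Many `H π`, and many thresholds between lower and
-- upper elements, induce the same partition; what it does determine is the set of paired elements
-- and the way they are matched (`matching-data-unique`). Conversely all such data occur
-- (`matchingPartition`), which gives the exact count `𝓜-size`.
--
-- The largest summand of `bound n` is compared with a power of `n` by an elementary estimate of
-- factorials. In particular `bound` beats every exponential, so a hereditary property with this
-- speed is itself superexponential and contains `𝓜`; having equally many partitions of each `[n]`,
-- the two coincide (`boundSpeed⇒⊆𝓜`).

private
  variable
    a b k l m n p : ℕ

-- Matrices avoiding a permutation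

sum-mono-≤ : {f g : Fin n → ℕ} → (∀ i → f i ≤ g i) → sum f ≤ sum g
sum-mono-≤ {zero}  f≤g = z≤n
sum-mono-≤ {suc n} f≤g = ℕ.+-mono-≤ (f≤g zero) (sum-mono-≤ (f≤g ∘ suc))

sum≤*-const : ∀ {c} {f : Fin n → ℕ} → (∀ i → f i ≤ c) → sum f ≤ n * c
sum≤*-const {zero}  f≤c = z≤n
sum≤*-const {suc n} f≤c = ℕ.+-mono-≤ (f≤c zero) (sum≤*-const (f≤c ∘ suc))

term≤sum : (f : Fin n → ℕ) (i : Fin n) → f i ≤ sum f
term≤sum f zero    = ℕ.m≤m+n _ _
term≤sum f (suc i) = ℕ.m≤n⇒m≤o+n (f zero) (term≤sum (f ∘ suc) i)

sum-++ : ∀ m (f : Fin (m + n) → ℕ) → sum f ≡ sum (f ∘ (_↑ˡ n)) + sum (f ∘ (m ↑ʳ_))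
sum-++ zero    f = refl
sum-++ (suc m) f = trans (cong (f zero +_) (sum-++ m (f ∘ suc))) (sym (ℕ.+-assoc (f zero) _ _))

sum-combine : ∀ m {n} (f : Fin (m * n) → ℕ) → sum f ≡ sum (λ i → sum (λ j → f (combine {m} i j)))
sum-combine zero        f = refl
sum-combine (suc m) {n} f = trans (sum-++ n f) (cong (sum (f ∘ (_↑ˡ m * n)) +_) (sum-combine m (f ∘ (n ↑ʳ_))))

⟦_⟧ : Bool → ℕ
⟦ b ⟧ = if b then 1 else 0

⟦_⟧≤1 : ∀ b → ⟦ b ⟧ ≤ 1
⟦ true  ⟧≤1 = ℕ.≤-refl
⟦ false ⟧≤1 = z≤n

count : (Fin n → Bool) → ℕ
count χ = sum (λ i → ⟦ χ i ⟧)

StrictlyMonotone : (Fin m → Fin n) → Set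
StrictlyMonotone f = f Preserves Fin._<_ ⟶ Fin._<_

cons-strictlyMonotone : {f : Fin m → Fin n} → StrictlyMonotone f →
  ∃ λ (g : Fin (suc m) → Fin (suc n)) → StrictlyMonotone g × g zero ≡ zero × (∀ i → g (suc i) ≡ suc (f i))
cons-strictlyMonotone {f = f} mono = g , g-mono , refl , λ _ → refl
  where
  g = λ { zero → zero ; (suc i) → suc (f i) }
  g-mono : StrictlyMonotone g
  g-mono {zero}  {suc j} _         = s≤s z≤n
  g-mono {suc i} {suc j} (s<s i<j) = s<s (mono i<j)

select : (χ : Fin n → Bool) → p ≤ count χ →
  ∃ λ (f : Fin p → Fin n) → StrictlyMonotone f × (∀ i → χ (f i) ≡ true)
select {p = zero}          χ _  = (λ ()) , (λ { {()} }) , λ ()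
select {suc n} {p = suc p} χ p≤ with χ zero in eq
... | false with f , mono , hit ← select (χ ∘ suc) p≤ =
      suc ∘ f , s<s ∘ mono , hit
... | true  with f , mono , hit ← select (χ ∘ suc) (s≤s⁻¹ p≤)
            with g , g-mono , g0 , gs ← cons-strictlyMonotone mono =
      g , g-mono , λ { zero → trans (cong χ g0) eq ; (suc i) → trans (cong χ (gs i)) (hit i) }

-- Pigeonhole by double counting: every marked index is counted in the class of its own code.
count≤classes : (code : Fin n → Fin m) (χ : Fin n → Bool) →
  (∀ c → count (λ i → χ i ∧ does (code i Fin.≟ c)) ≤ p) → count χ ≤ m * p
count≤classes {m = m} {p} code χ few = begin
  sum (λ i → ⟦ χ i ⟧)                              ≤⟨ sum-mono-≤ (λ i → own-class i) ⟩
  sum (λ i → sum (λ c → ⟦ χ i ∧ does (code i Fin.≟ c) ⟧)) ≡⟨ Sum.∑-comm (λ i c → ⟦ χ i ∧ does (code i Fin.≟ c) ⟧) ⟩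
  sum (λ c → sum (λ i → ⟦ χ i ∧ does (code i Fin.≟ c) ⟧)) ≤⟨ sum≤*-const few ⟩
  m * p                                            ∎
  where
  open ℕ.≤-Reasoning
  own-class : ∀ i → ⟦ χ i ⟧ ≤ sum (λ c → ⟦ χ i ∧ does (code i Fin.≟ c) ⟧)
  own-class i = begin
    ⟦ χ i ⟧                                   ≡⟨ cong ⟦_⟧ (Bool.∧-identityʳ (χ i)) ⟨
    ⟦ χ i ∧ true ⟧                            ≡⟨ cong (λ b → ⟦ χ i ∧ b ⟧) (dec-true (code i Fin.≟ code i) refl) ⟨
    ⟦ χ i ∧ does (code i Fin.≟ code i) ⟧      ≤⟨ term≤sum (λ c → ⟦ χ i ∧ does (code i Fin.≟ c) ⟧) (code i) ⟩
    sum (λ c → ⟦ χ i ∧ does (code i Fin.≟ c) ⟧) ∎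

does⁻ : ∀ {a} {A : Set a} (A? : Dec A) → does A? ≡ true → A
does⁻ (yes a) _ = a

anyᵇ : (Fin n → Bool) → Bool
anyᵇ χ = does (Fin.any? (λ i → χ i Bool.≟ true))

anyᵇ⁺ : (χ : Fin n → Bool) (i : Fin n) → χ i ≡ true → anyᵇ χ ≡ true
anyᵇ⁺ χ i χi = dec-true (Fin.any? (λ i → χ i Bool.≟ true)) (i , χi)

anyᵇ⁻ : (χ : Fin n → Bool) → anyᵇ χ ≡ true → ∃ λ i → χ i ≡ true
anyᵇ⁻ χ = does⁻ (Fin.any? (λ i → χ i Bool.≟ true))

⟦⟧-mono : ∀ {a b} → (a ≡ true → b ≡ true) → ⟦ a ⟧ ≤ ⟦ b ⟧
⟦⟧-mono {false} _   = z≤n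
⟦⟧-mono {true}  a⇒b = ℕ.≤-reflexive (cong ⟦_⟧ (sym (a⇒b refl)))

⟦∧⟧ : ∀ a b → ⟦ a ∧ b ⟧ ≡ ⟦ a ⟧ * ⟦ b ⟧
⟦∧⟧ false b = refl
⟦∧⟧ true  b = sym (ℕ.+-identityʳ ⟦ b ⟧)

∧⁻ : ∀ {a b} → a ∧ b ≡ true → a ≡ true × b ≡ true
∧⁻ {true} eq = refl , eq

combine-monoʳ-< : ∀ (i : Fin m) {j l : Fin n} → j Fin.< l → combine i j Fin.< combine i l
combine-monoʳ-< {n = n} i {j} {l} j<l = begin-strict
  toℕ (combine i j)   ≡⟨ Fin.toℕ-combine i j ⟩
  n * toℕ i + toℕ j   <⟨ ℕ.+-monoʳ-< (n * toℕ i) j<l ⟩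
  n * toℕ i + toℕ l   ≡⟨ Fin.toℕ-combine i l ⟨
  toℕ (combine i l)   ∎
  where open ℕ.≤-Reasoning

-- Patterns, blocks and contraction

Matrix : ℕ → Set
Matrix n = Fin n → Fin n → Bool

infix 10 _ᵀ
_ᵀ : Matrix n → Matrix n
(M ᵀ) i j = M j i

ones : Matrix n → ℕ
ones M = sum (λ i → count (M i))

record HasPattern (σ : Permutation′ p) (M : Matrix n) : Set where
  field
    rows cols : Fin p → Fin n
    rows-mono : StrictlyMonotone rows
    cols-mono : StrictlyMonotone cols
    entry     : ∀ i → M (rows i) (cols (σ ⟨$⟩ʳ i)) ≡ true

open HasPattern

Avoids : Permutation′ p → Matrix n → Set
Avoids σ M = ¬ HasPattern σ M

hasPattern-ᵀ : (σ : Permutation′ p) (M : Matrix n) → HasPattern (flip σ) (M ᵀ) → HasPattern σ M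
hasPattern-ᵀ σ M c = record
  { rows = cols c ; cols = rows c ; rows-mono = cols-mono c ; cols-mono = rows-mono c
  ; entry = λ i → subst (λ j → M (cols c j) (rows c (σ ⟨$⟩ʳ i)) ≡ true) (inverseˡ σ) (entry c (σ ⟨$⟩ʳ i)) }

module _ {n b : ℕ} where

  block : Matrix (n * b) → Fin n → Fin n → Matrix b
  block M I J i j = M (combine I i) (combine J j)

nonzero : Matrix n → Bool
nonzero B = anyᵇ (λ i → anyᵇ (B i))

contract : ∀ {n b} → Matrix (n * b) → Matrix n
contract {n} M I J = nonzero (block {n} M I J)

contract⁺ : ∀ {n b} (M : Matrix (n * b)) {I J : Fin n} {i j : Fin b} →
  M (combine I i) (combine J j) ≡ true → contract {n} M I J ≡ true
contract⁺ {n} M {I} {J} {i} {j} eq =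
  anyᵇ⁺ (λ i → anyᵇ (block {n} M I J i)) i (anyᵇ⁺ (block {n} M I J i) j eq)

nonzeroColumn : Matrix n → Fin n → Bool
nonzeroColumn B j = anyᵇ (λ i → B i j)

wide : ℕ → Matrix n → Bool
wide p B = p ≤ᵇ count (nonzeroColumn B)

-- One entry from each block used suffices: the blocks of a permutation pattern lie in distinct
-- block rows and block columns, so the chosen entries are ordered as their blocks are.
hasPattern-contract : ∀ {b} (σ : Permutation′ p) (M : Matrix (n * b)) →
  HasPattern σ (contract {n} {b} M) → HasPattern σ M
hasPattern-contract {n = n} {b} σ M c = record
  { rows = λ i → combine (rows c i) (proj₁ (hit i))
  -- The entries are found row by row, so the one in column `j` is looked up at the row that `σ`
  -- sends to `j`.
  ; cols = λ j → combine (cols c j) (proj₁ (proj₂ (hit (σ ⟨$⟩ˡ j))))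
  ; rows-mono = λ i<j → Fin.combine-monoˡ-< _ _ (rows-mono c i<j)
  ; cols-mono = λ i<j → Fin.combine-monoˡ-< _ _ (cols-mono c i<j)
  ; entry = λ i → subst (λ i′ → M (combine (rows c i) (proj₁ (hit i)))
                                  (combine (cols c (σ ⟨$⟩ʳ i)) (proj₁ (proj₂ (hit i′)))) ≡ true)
                        (sym (inverseˡ σ)) (proj₂ (proj₂ (hit i)))
  }
  where
  hit : ∀ i → ∃₂ λ x y → block {n} M (rows c i) (cols c (σ ⟨$⟩ʳ i)) x y ≡ true
  hit i =
    let B = block {n} M (rows c i) (cols c (σ ⟨$⟩ʳ i))
        x , ∃y = anyᵇ⁻ (λ x → anyᵇ (B x)) (entry c i)
    in x , anyᵇ⁻ (B x) ∃y

ones≤n*n : (B : Matrix n) → ones B ≤ n * n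
ones≤n*n {n} B = sum≤*-const λ i →
  ℕ.≤-trans (sum≤*-const (λ j → ⟦ B i j ⟧≤1)) (ℕ.≤-reflexive (ℕ.*-identityʳ n))

count-narrow : ∀ p (χ : Fin n → Bool) → (p ≤ᵇ count χ) ≡ false → count χ ≤ p
count-narrow p χ eq =
  ℕ.<⇒≤ (ℕ.≰⇒> λ p≤ → contradiction (trans (sym eq) (Equivalence.to Bool.T-≡ (ℕ.≤⇒≤ᵇ p≤))) λ ())

-- Each one lies in the product of the non-zero rows and the non-zero columns.
ones≤rows*columns : (B : Matrix n) → ones B ≤ count (nonzeroColumn (B ᵀ)) * count (nonzeroColumn B)
ones≤rows*columns B = begin
  sum (λ i → sum (λ j → ⟦ B i j ⟧))
    ≤⟨ sum-mono-≤ (λ i → sum-mono-≤ λ j → ℕ.≤-trans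
         (⟦⟧-mono λ Bij → cong₂ _∧_ (anyᵇ⁺ (B i) j Bij) (anyᵇ⁺ (λ i → B i j) i Bij))
         (ℕ.≤-reflexive (⟦∧⟧ (anyᵇ (B i)) (nonzeroColumn B j)))) ⟩
  sum (λ i → sum (λ j → r i * c j))
    ≡⟨ Sum.sum-cong-≗ (λ i → SemiringSum.*-distribˡ-sum (r i) c) ⟨
  sum (λ i → r i * sum c)
    ≡⟨ SemiringSum.*-distribʳ-sum (sum c) r ⟨
  sum r * sum c ∎
  where
  open ℕ.≤-Reasoning
  r = λ i → ⟦ nonzeroColumn (B ᵀ) i ⟧
  c = λ j → ⟦ nonzeroColumn B j ⟧

ones-zero : (B : Matrix n) → nonzero B ≡ false → ones B ≤ 0
ones-zero {n} B none = begin
  ones B ≤⟨ sum≤*-const (λ i → ℕ.≤-trans (sum≤*-const (λ j → ⟦⟧-mono {B i j} {false} λ Bij →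
              trans (sym none) (anyᵇ⁺ (λ i → anyᵇ (B i)) i (anyᵇ⁺ (B i) j Bij))))
              (ℕ.≤-reflexive (ℕ.*-zeroʳ n))) ⟩
  n * 0  ≡⟨ ℕ.*-zeroʳ n ⟩
  0      ∎
  where open ℕ.≤-Reasoning

-- A wide or tall block is charged its full area, and any other non-zero block at most `p` rows
-- times `p` columns. A single inequality in indicators, rather than a case distinction, can be
-- summed over all blocks.
ones-block : ∀ p (B : Matrix n) →
  ones B ≤ (p * p) * ⟦ nonzero B ⟧ + (n * n) * ⟦ wide p B ⟧ + (n * n) * ⟦ wide p (B ᵀ) ⟧
ones-block {n} p B with wide p B in w | wide p (B ᵀ) in t | nonzero B in z
... | true  | t′    | z′    = ℕ.m≤n⇒m≤n+o _ (ℕ.m≤n⇒m≤o+n ((p * p) * ⟦ z′ ⟧)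
      (ℕ.≤-trans (ones≤n*n B) (ℕ.≤-reflexive (sym (ℕ.*-identityʳ (n * n))))))
... | false | true  | z′    = ℕ.m≤n⇒m≤o+n ((p * p) * ⟦ z′ ⟧ + (n * n) * 0)
      (ℕ.≤-trans (ones≤n*n B) (ℕ.≤-reflexive (sym (ℕ.*-identityʳ (n * n)))))
... | false | false | false = ℕ.≤-trans (ones-zero B z) z≤n
... | false | false | true  = ℕ.m≤n⇒m≤n+o _ (ℕ.m≤n⇒m≤n+o _ (begin
      ones B                                                ≤⟨ ones≤rows*columns B ⟩
      count (nonzeroColumn (B ᵀ)) * count (nonzeroColumn B) ≤⟨ ℕ.*-mono-≤ (count-narrow p (nonzeroColumn (B ᵀ)) t)
                                                                          (count-narrow p (nonzeroColumn B) w) ⟩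
      p * p                                                 ≡⟨ ℕ.*-identityʳ (p * p) ⟨
      (p * p) * 1                                           ∎))
  where open ℕ.≤-Reasoning

bit : Bool → Fin 2
bit true  = suc zero
bit false = zero

bit-injective : ∀ {x y} → bit x ≡ bit y → x ≡ y
bit-injective {true}  {true}  _ = refl
bit-injective {false} {false} _ = refl

funToFin-injective : {f g : Fin m → Fin n} → funToFin f ≡ funToFin g → f ≗ g
funToFin-injective {f = f} {g} eq i =
  trans (sym (Fin.finToFun-funToFin f i)) (trans (cong (λ c → Fin.finToFun c i) eq) (Fin.finToFun-funToFin g i))

-- p + 1 wide blocks in one block column having the same non-zero columns
-- contain the pattern: use one block per row of the pattern.
wide-blocks-few : (σ : Permutation′ p) (M : Matrix (n * b)) → Avoids σ M →
  ∀ J → count (λ I → wide p (block {n} M I J)) ≤ 2 ^ b * p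
wide-blocks-few {p} {n} {b} σ M avoids J =
  count≤classes code (λ I → wide p (B I)) λ c → ℕ.≮⇒≥ (avoids ∘ pattern-from c)
  where
  B = λ I → block {n} M I J
  code : Fin n → Fin (2 ^ b)
  code I = funToFin (bit ∘ nonzeroColumn (B I))

  pattern-from : ∀ c → p < count (λ I → wide p (B I) ∧ does (code I Fin.≟ c)) → HasPattern σ M
  pattern-from c p< = record
    { rows      = λ i → combine (d (suc i)) (proj₁ (hit i))
    ; cols      = λ j → combine J (e j)
    ; rows-mono = λ i<j → Fin.combine-monoˡ-< _ _ (d-mono (s<s i<j))
    ; cols-mono = λ i<j → combine-monoʳ-< J (e-mono i<j)
    ; entry     = λ i → proj₂ (hit i)
    }
    where
    selected = select (λ I → wide p (B I) ∧ does (code I Fin.≟ c)) p<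
    d        = proj₁ selected
    d-mono   = proj₁ (proj₂ selected)
    d-code : ∀ i → code (d i) ≡ c
    d-code i = does⁻ (code (d i) Fin.≟ c) (proj₂ (∧⁻ (proj₂ (proj₂ selected) i)))
    -- The first of the `p + 1` blocks supplies the columns and the other `p` one row each. All have
    -- the same non-zero columns, so each of them has a one in every selected column.
    columns  = select (nonzeroColumn (B (d zero)))
                 (ℕ.≤ᵇ⇒≤ p _ (Equivalence.from Bool.T-≡ (proj₁ (∧⁻ (proj₂ (proj₂ selected) zero)))))
    e        = proj₁ columns
    e-mono   = proj₁ (proj₂ columns)
    hit : ∀ i → ∃ λ x → B (d (suc i)) x (e (σ ⟨$⟩ʳ i)) ≡ true
    hit i = anyᵇ⁻ (λ x → B (d (suc i)) x (e (σ ⟨$⟩ʳ i)))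
      (trans (bit-injective (funToFin-injective (trans (d-code (suc i)) (sym (d-code zero))) (e (σ ⟨$⟩ʳ i))))
             (proj₂ (proj₂ columns) (σ ⟨$⟩ʳ i)))

ones-blocks : (M : Matrix (n * b)) → ones M ≡ sum (λ I → sum (λ J → ones (block {n} M I J)))
ones-blocks {n} {b} M = begin
  sum (λ i → sum (λ j → ⟦ M i j ⟧))
    ≡⟨ sum-combine n {b} (λ i → count (M i)) ⟩
  sum (λ I → sum (λ i → sum (λ j → ⟦ M (combine {n} {b} I i) j ⟧)))
    ≡⟨ Sum.sum-cong-≗ (λ I → Sum.sum-cong-≗ λ i → sum-combine n {b} (λ j → ⟦ M (combine {n} {b} I i) j ⟧)) ⟩
  sum (λ I → sum (λ i → sum (λ J → sum (λ j → ⟦ block {n} {b} M I J i j ⟧))))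
    ≡⟨ Sum.sum-cong-≗ (λ I → Sum.∑-comm (λ i J → sum (λ j → ⟦ block {n} {b} M I J i j ⟧))) ⟩
  sum (λ I → sum (λ J → ones (block {n} {b} M I J))) ∎
  where open ≡.≡-Reasoning

-- Sums `ones-block` over all blocks. Tall blocks are the wide blocks of the transpose, which avoids
-- the inverse of `σ`.
ones-contract : (σ : Permutation′ p) (M : Matrix (n * b)) → Avoids σ M →
  ones M ≤ (p * p) * ones (contract {n} M) + (b * b) * (n * (2 ^ b * p)) + (b * b) * (n * (2 ^ b * p))
ones-contract {p} {n} {b} σ M avoids = begin
  ones M
    ≡⟨ ones-blocks {n} M ⟩
  ∑∑ (λ I J → ones (B I J))
    ≤⟨ sum-mono-≤ (λ I → sum-mono-≤ λ J → ones-block p (B I J)) ⟩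
  ∑∑ (λ I J → x I J + y I J + z I J)
    ≡⟨ split₂ (λ I J → x I J + y I J) z ⟩
  ∑∑ (λ I J → x I J + y I J) + ∑∑ z
    ≡⟨ cong (_+ ∑∑ z) (split₂ x y) ⟩
  ∑∑ x + ∑∑ y + ∑∑ z
    ≡⟨ cong₂ _+_ (cong₂ _+_ (scale₂ (p * p) _) (scale₂ (b * b) _)) (scale₂ (b * b) _) ⟨
  (p * p) * ones (contract {n} M) + (b * b) * ∑∑ (λ I J → ⟦ wide p (B I J) ⟧) + (b * b) * ∑∑ (λ I J → ⟦ wide p (B I J ᵀ) ⟧)
    ≤⟨ ℕ.+-mono-≤ (ℕ.+-monoʳ-≤ ((p * p) * ones (contract {n} M)) (ℕ.*-monoʳ-≤ (b * b) wide-few)) (ℕ.*-monoʳ-≤ (b * b) tall-few) ⟩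
  (p * p) * ones (contract {n} M) + (b * b) * (n * (2 ^ b * p)) + (b * b) * (n * (2 ^ b * p)) ∎
  where
  open ℕ.≤-Reasoning
  B = block {n} M

  ∑∑ : (Fin n → Fin n → ℕ) → ℕ
  ∑∑ f = sum (λ I → sum (f I))

  x y z : Fin n → Fin n → ℕ
  x I J = (p * p) * ⟦ nonzero (B I J) ⟧
  y I J = (b * b) * ⟦ wide p (B I J) ⟧
  z I J = (b * b) * ⟦ wide p (B I J ᵀ) ⟧

  split₂ : (f g : Fin n → Fin n → ℕ) →
    ∑∑ (λ I J → f I J + g I J) ≡ ∑∑ f + ∑∑ g
  split₂ f g = trans (Sum.sum-cong-≗ (λ I → Sum.∑-distrib-+ (f I) (g I))) (Sum.∑-distrib-+ (λ I → sum (f I)) (λ I → sum (g I)))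

  scale₂ : ∀ c (f : Fin n → Fin n → ℕ) → c * ∑∑ f ≡ ∑∑ (λ I J → c * f I J)
  scale₂ c f = trans (SemiringSum.*-distribˡ-sum c (λ I → sum (f I))) (Sum.sum-cong-≗ (λ I → SemiringSum.*-distribˡ-sum c (f I)))

  wide-few : ∑∑ (λ I J → ⟦ wide p (B I J) ⟧) ≤ n * (2 ^ b * p)
  wide-few = ℕ.≤-trans (ℕ.≤-reflexive (Sum.∑-comm (λ I J → ⟦ wide p (B I J) ⟧)))
                       (sum≤*-const (wide-blocks-few {n = n} σ M avoids))

  tall-few : ∑∑ (λ I J → ⟦ wide p (B I J ᵀ) ⟧) ≤ n * (2 ^ b * p)
  tall-few = sum≤*-const (wide-blocks-few {n = n} (flip σ) (M ᵀ) (avoids ∘ hasPattern-ᵀ σ M))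

-- The two steps of the Marcus–Tardos theorem for matrices whose size is a
-- power of β; any β > p² would do.
module MarcusTardos (σ : Permutation′ p) where

  β : ℕ
  β = p * p + 2

  -- `W + W` is the coefficient of `n` that wide and tall blocks contribute in `ones-contract`; the
  -- successor makes `γ` positive for the one-by-one matrix.
  W γ : ℕ
  W = (β * β) * (2 ^ β * p)
  γ = suc (W + W)

  LinearOnes : ℕ → Set
  LinearOnes n = (M : Matrix n) → Avoids σ M → ones M ≤ γ * n

  linearOnes-1 : LinearOnes 1
  linearOnes-1 M _ = ℕ.≤-trans (ones≤n*n M) (ℕ.*-monoˡ-≤ 1 {1} {γ} (s≤s z≤n))

  -- The recursion closes because `p * p` copies of `γ * n` and a remainder of at most two more make
  -- up `γ * (n * β)`.
  linearOnes-* : LinearOnes n → LinearOnes (n * β)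
  linearOnes-* {n} linear M avoids = begin
    ones M ≤⟨ ones-contract {n = n} σ M avoids ⟩
    (p * p) * ones (contract {n} M) + (β * β) * (n * (2 ^ β * p)) + (β * β) * (n * (2 ^ β * p))
      ≤⟨ ℕ.+-monoˡ-≤ _ (ℕ.+-monoˡ-≤ _ (ℕ.*-monoʳ-≤ (p * p) (linear (contract {n} M)
        (avoids ∘ hasPattern-contract {n = n} σ M)))) ⟩
    (p * p) * (γ * n) + (β * β) * (n * (2 ^ β * p)) + (β * β) * (n * (2 ^ β * p))
      ≡⟨ arith p n (β * β) (2 ^ β * p) ⟩
    (W + W) * n + (p * p) * (γ * n)
      ≤⟨ ℕ.+-monoˡ-≤ ((p * p) * (γ * n)) (ℕ.*-monoˡ-≤ n (ℕ.m≤n⇒m≤n+o γ (ℕ.n≤1+n (W + W)))) ⟩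
    (γ + γ) * n + (p * p) * (γ * n)
      ≡⟨ arith′ p n γ ⟩
    γ * (n * β) ∎
    where
    open ℕ.≤-Reasoning
    open import Data.Nat.Tactic.RingSolver
    arith : ∀ p n x y → (p * p) * (suc (x * y + x * y) * n) + x * (n * y) + x * (n * y) ≡
            (x * y + x * y) * n + (p * p) * (suc (x * y + x * y) * n)
    arith = solve-∀
    arith′ : ∀ p n γ → (γ + γ) * n + (p * p) * (γ * n) ≡ γ * (n * (p * p + 2))
    arith′ = solve-∀

-- Encodings of the matrices that avoid a pattern

⟦⟧≤0⇒false : ∀ {x} → ⟦ x ⟧ ≤ 0 → x ≡ false
⟦⟧≤0⇒false {false} _ = refl

-- Only the first l elements of the support of χ are recorded.
encodeSupport : ∀ l (χ : Fin m → Bool) (f : Fin m → Fin a) → Fin a → Fin (a ^ l)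
encodeSupport         zero    χ f d = zero
-- The slots left over are filled with the default `d`, so that all codes have length `l`.
encodeSupport {zero}  (suc l) χ f d = funToFin {suc l} (λ _ → d)
encodeSupport {suc m} (suc l) χ f d with χ zero
... | true  = combine (f zero) (encodeSupport l (χ ∘ suc) (f ∘ suc) d)
... | false = encodeSupport (suc l) (χ ∘ suc) (f ∘ suc) d

-- With equal supports both encoders advance in step, and the bound on the support ensures that the
-- truncation to `l` values loses nothing.
encodeSupport-injective : ∀ l {χ χ′ : Fin m → Bool} {f f′ : Fin m → Fin a} d → χ ≗ χ′ → count χ ≤ l →
  encodeSupport l χ f d ≡ encodeSupport l χ′ f′ d → ∀ i → χ i ≡ true → f i ≡ f′ i
encodeSupport-injective zero {χ} d χ≗ few eq i χi
  with () ← trans (sym χi) (⟦⟧≤0⇒false (ℕ.≤-trans (term≤sum (⟦_⟧ ∘ χ) i) few))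
encodeSupport-injective {suc m} (suc l) {χ} {χ′} {f} {f′} d χ≗ few eq i χi with χ zero in χ0 | χ′ zero in χ′0 | i
... | true  | false | _     = contradiction (trans (sym χ0) (trans (χ≗ zero) χ′0)) λ ()
... | false | true  | _     = contradiction (trans (sym χ0) (trans (χ≗ zero) χ′0)) λ ()
... | false | false | zero  = contradiction (trans (sym χ0) χi) λ ()
... | false | false | suc i = encodeSupport-injective (suc l) d (χ≗ ∘ suc) few eq i χi
... | true  | true  | zero  = Fin.combine-injectiveˡ (f zero) _ (f′ zero) _ eq
... | true  | true  | suc i =
  encodeSupport-injective l d (χ≗ ∘ suc) (s≤s⁻¹ few) (Fin.combine-injectiveʳ (f zero) _ (f′ zero) _ eq) i χi

infix 4 _≗₂_
_≗₂_ : Matrix n → Matrix n → Set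
M ≗₂ M′ = ∀ i j → M i j ≡ M′ i j

encodeMatrix : Matrix n → Fin ((2 ^ n) ^ n)
encodeMatrix B = funToFin (λ i → funToFin (bit ∘ B i))

encodeMatrix-injective : {M M′ : Matrix n} → encodeMatrix M ≡ encodeMatrix M′ → M ≗₂ M′
encodeMatrix-injective eq i j = bit-injective (funToFin-injective (funToFin-injective eq i) j)

-- States that at most `c ^ n` matrices avoid `σ`. The code is defined on all matrices but has to
-- separate only the avoiding ones, and those up to pointwise equality.
record Encoding (σ : Permutation′ p) (n c : ℕ) : Set where
  field
    encode    : Matrix n → Fin (c ^ n)
    injective : ∀ {M M′} → Avoids σ M → Avoids σ M′ → encode M ≡ encode M′ → M ≗₂ M′

flatten : Matrix n → Fin (n * n) → Bool
flatten {n} M = uncurry M ∘ remQuot n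

count-flatten : (M : Matrix n) → count (flatten M) ≡ ones M
count-flatten {n} M = trans (sum-combine n {n} (⟦_⟧ ∘ flatten M))
  (Sum.sum-cong-≗ λ i → Sum.sum-cong-≗ λ j → cong (⟦_⟧ ∘ uncurry M) (Fin.remQuot-combine i j))

-- Where the common contraction is zero both matrices vanish, so only the non-zero blocks have to be
-- compared.
contract-≗₂ : (M M′ : Matrix (n * b)) → contract {n} M ≗₂ contract {n} M′ →
  (∀ I J → contract {n} M I J ≡ true → block {n} M I J ≗₂ block {n} M′ I J) → M ≗₂ M′
contract-≗₂ {n} {b} M M′ same-contract same-block x y
  with I , i , refl ← Fin.combine-surjective {n} {b} x | J , j , refl ← Fin.combine-surjective {n} {b} y
  with M (combine I i) (combine J j) in eq | M′ (combine I i) (combine J j) in eq′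
... | true  | true  = refl
... | false | false = refl
... | true  | false = trans (sym eq) (trans (same-block I J (contract⁺ {n} {b} M {I} {J} {i} {j} eq) i j) eq′)
... | false | true  = trans (sym eq)
  (trans (same-block I J (trans (same-contract I J) (contract⁺ {n} {b} M′ {I} {J} {i} {j} eq′)) i j) eq′)

-- Klazar's argument: a matrix avoiding σ is determined by its contraction
-- together with the contents of the linearly many non-zero blocks.
module _ {σ : Permutation′ p} where
  open MarcusTardos σ

  private
    -- `A` bounds the number of blocks. Passing from size `n` to `n * β` costs a factor
    -- `A ^ (γ * n)`, at most `c ^ n`, which fits since `β` is at least two. The factor `2` in `c`
    -- provides for the two one-by-one matrices.
    A c : ℕ
    A = (2 ^ β) ^ β
    c = 2 * A ^ γ

    instance
      A≢0 : NonZero A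
      A≢0 = ℕ.m^n≢0 (2 ^ β) β {{ℕ.m^n≢0 2 β}}

      A^C≢0 : NonZero (A ^ γ)
      A^C≢0 = ℕ.m^n≢0 A γ

      c≢0 : NonZero c
      c≢0 = ℕ.m*n≢0 2 (A ^ γ)

  codes-fit : ∀ n → c ^ n * A ^ (γ * n) ≤ c ^ (n * β)
  codes-fit n = begin
    c ^ n * A ^ (γ * n)   ≡⟨ cong (c ^ n *_) (ℕ.^-*-assoc A γ n) ⟨
    c ^ n * (A ^ γ) ^ n   ≤⟨ ℕ.*-monoʳ-≤ (c ^ n) (ℕ.^-monoˡ-≤ n (ℕ.m≤n*m (A ^ γ) 2)) ⟩
    c ^ n * c ^ n         ≡⟨ ℕ.^-distribˡ-+-* c n n ⟨
    c ^ (n + n)           ≤⟨ ℕ.^-monoʳ-≤ c double ⟩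
    c ^ (n * β)           ∎
    where
    open ℕ.≤-Reasoning
    double : n + n ≤ n * β
    double = begin
      n + n        ≡⟨ cong (n +_) (ℕ.+-identityʳ n) ⟨
      2 * n        ≡⟨ ℕ.*-comm 2 n ⟩
      n * 2        ≤⟨ ℕ.*-monoʳ-≤ n (ℕ.m≤n+m 2 (p * p)) ⟩
      n * β        ∎

  encoding-1 : Encoding σ 1 c
  encoding-1 = record
    { encode    = λ M → inject≤ (bit (M zero zero)) 2≤c
    ; injective = λ { _ _ eq zero zero → bit-injective (Fin.inject≤-injective 2≤c 2≤c _ _ eq) }
    }
    where
    2≤c : 2 ≤ c ^ 1
    2≤c = ℕ.≤-trans (ℕ.m≤m*n 2 (A ^ γ)) (ℕ.≤-reflexive (sym (ℕ.^-identityʳ c)))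

  encoding-* : LinearOnes n → Encoding σ n c → Encoding σ (n * β) c
  encoding-* {n} linear E = record
    { encode    = λ M → inject≤ (code M) (codes-fit n)
    ; injective = λ {M} {M′} av av′ eq →
        let codes = Fin.inject≤-injective (codes-fit n) (codes-fit n) _ _ eq
            same-contract = E.injective (av ∘ hasPattern-contract {n = n} σ M) (av′ ∘ hasPattern-contract {n = n} σ M′)
                              (Fin.combine-injectiveˡ (E.encode (contract {n} M)) _ (E.encode (contract {n} M′)) _ codes)
        in contract-≗₂ {n} {β} M M′ same-contract λ I J hit →
             encodeMatrix-injective {β} (trans (sym (blockCode-combine M I J)) (trans
               (encodeSupport-injective (γ * n) {f = blockCode M} {blockCode M′} d
                 (λ x → uncurry same-contract (remQuot n x))
                 (ℕ.≤-trans (ℕ.≤-reflexive (count-flatten (contract {n} M))) (linear _ (av ∘ hasPattern-contract {n = n} σ M)))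
                 (Fin.combine-injectiveʳ (E.encode (contract {n} M)) _ (E.encode (contract {n} M′)) _ codes)
                 (combine I J)
                 (trans (cong (uncurry (contract {n} M)) (Fin.remQuot-combine I J)) hit))
               (blockCode-combine M′ I J)))
    }
    where
    module E = Encoding E
    d : Fin A
    d = encodeMatrix {β} (λ _ _ → false)
    blockCode : Matrix (n * β) → Fin (n * n) → Fin A
    blockCode M = uncurry (λ I J → encodeMatrix (block {n} M I J)) ∘ remQuot n
    blockCode-combine : ∀ M I J → blockCode M (combine I J) ≡ encodeMatrix (block {n} M I J)
    blockCode-combine M I J = cong (uncurry (λ I J → encodeMatrix (block {n} M I J))) (Fin.remQuot-combine I J)
    code : Matrix (n * β) → Fin (c ^ n * A ^ (γ * n))
    code M = combine (E.encode (contract {n} M)) (encodeSupport (γ * n) (flatten (contract {n} M)) (blockCode M) d)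

  size : ℕ → ℕ
  size zero    = 1
  size (suc j) = size j * β

  linearOnes-size : ∀ j → LinearOnes (size j)
  linearOnes-size zero    = linearOnes-1
  linearOnes-size (suc j) = linearOnes-* (linearOnes-size j)

  encoding-size : ∀ j → Encoding σ (size j) c
  encoding-size zero    = encoding-1
  encoding-size (suc j) = encoding-* (linearOnes-size j) (encoding-size j)

  -- By induction on `n`, moving to the next power of `β` exactly when the current one is used up.
  -- Padding to such a size replaces the base `c` by `c ^ β`.
  size-between : ∀ n → ∃ λ j → suc n ≤ size j × size j ≤ suc n * β
  size-between zero    = 0 , ℕ.≤-refl , ℕ.≤-trans (ℕ.m≤n+m 1 (p * p + 1))
    (ℕ.≤-reflexive (trans (ℕ.+-assoc (p * p) 1 1) (sym (ℕ.*-identityˡ β))))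
  size-between (suc n) with size-between n
  ... | j , lower , upper with ℕ.m≤n⇒m<n∨m≡n lower
  ...   | inj₁ larger = j , larger , ℕ.≤-trans upper (ℕ.*-monoˡ-≤ β (ℕ.n≤1+n (suc n)))
  ...   | inj₂ eq     = suc j , grows , ℕ.≤-trans (ℕ.*-monoˡ-≤ β (ℕ.≤-reflexive (sym eq))) (ℕ.*-monoˡ-≤ β (ℕ.n≤1+n (suc n)))
    where
    open ℕ.≤-Reasoning
    grows : suc (suc n) ≤ size j * β
    grows = begin
      suc (suc n)     ≤⟨ s≤s (ℕ.m≤n+m (suc n) n) ⟩
      suc n + suc n   ≡⟨ cong (suc n +_) (ℕ.+-identityʳ (suc n)) ⟨
      2 * suc n       ≡⟨ ℕ.*-comm 2 (suc n) ⟩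
      suc n * 2       ≤⟨ ℕ.*-mono-≤ lower (ℕ.m≤n+m 2 (p * p)) ⟩
      size j * β      ∎

  module _ (n≤m : n ≤ m) where

    private
      ι = λ (i : Fin n) → inject≤ i n≤m
      ι-reflects-< : ∀ {i j} → ι i Fin.< ι j → i Fin.< j
      ι-reflects-< {i} {j} = ≡.subst₂ _<_ (Fin.toℕ-inject≤ i n≤m) (Fin.toℕ-inject≤ j n≤m)

    pad : Matrix n → Matrix m
    pad M x y = anyᵇ λ i → anyᵇ λ j → does (ι i Fin.≟ x) ∧ (does (ι j Fin.≟ y) ∧ M i j)

    pad⁺ : ∀ M {i j} → M i j ≡ true → pad M (ι i) (ι j) ≡ true
    pad⁺ M {i} {j} Mij = anyᵇ⁺ _ i (anyᵇ⁺ _ j (cong₂ _∧_ (dec-true (ι i Fin.≟ ι i) refl)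
                                        (cong₂ _∧_ (dec-true (ι j Fin.≟ ι j) refl) Mij)))

    pad⁻ : ∀ M {x y} → pad M x y ≡ true → ∃₂ λ i j → ι i ≡ x × ι j ≡ y × M i j ≡ true
    pad⁻ M {x} {y} hit =
      let i , hit′  = anyᵇ⁻ (λ i → anyᵇ λ j → does (ι i Fin.≟ x) ∧ (does (ι j Fin.≟ y) ∧ M i j)) hit
          j , hit″  = anyᵇ⁻ (λ j → does (ι i Fin.≟ x) ∧ (does (ι j Fin.≟ y) ∧ M i j)) hit′
          ix , rest = ∧⁻ hit″
          jy , Mij  = ∧⁻ rest
      in i , j , does⁻ (ι i Fin.≟ x) ix , does⁻ (ι j Fin.≟ y) jy , Mij

    pad-reflects : ∀ M {i j} → pad M (ι i) (ι j) ≡ true → M i j ≡ true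
    pad-reflects M {i} {j} hit with i′ , j′ , eq , eq′ , Mij ← pad⁻ M hit =
      ≡.subst₂ (λ i j → M i j ≡ true) (Fin.inject≤-injective n≤m n≤m _ _ eq) (Fin.inject≤-injective n≤m n≤m _ _ eq′) Mij

    pad-injective : ∀ {M M′} → pad M ≗₂ pad M′ → M ≗₂ M′
    pad-injective {M} {M′} eq i j with M i j in e | M′ i j in e′
    ... | true  | true  = refl
    ... | false | false = refl
    ... | true  | false = trans (sym (pad-reflects M′ (trans (sym (eq (ι i) (ι j))) (pad⁺ M e)))) e′
    ... | false | true  = trans (sym e) (pad-reflects M (trans (eq (ι i) (ι j)) (pad⁺ M′ e′)))

    -- All ones of the padded matrix come from `M`, so a pattern among them pulls back along the
    -- increasing map `ι`.
    pad-hasPattern : ∀ M → HasPattern σ (pad M) → HasPattern σ M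
    pad-hasPattern M h = record
      { rows = r ; cols = q ∘ (σ ⟨$⟩ˡ_)
      ; rows-mono = λ {i} {j} i<j → ι-reflects-< (≡.subst₂ Fin._<_ (sym (ιr i)) (sym (ιr j)) (rows-mono h i<j))
      ; cols-mono = λ {i} {j} i<j → ι-reflects-< (≡.subst₂ Fin._<_ (sym (ιq i)) (sym (ιq j)) (cols-mono h i<j))
      ; entry     = λ i → subst (λ i′ → M (r i) (q i′) ≡ true) (sym (inverseˡ σ)) (proj₂ (proj₂ (proj₂ (proj₂ (hit i)))))
      }
      where
      hit = λ i → pad⁻ M (entry h i)
      r   = λ i → proj₁ (hit i)
      q   = λ i → proj₁ (proj₂ (hit i))
      ιr : ∀ i → ι (r i) ≡ rows h i
      ιr i = proj₁ (proj₂ (proj₂ (hit i)))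
      ιq : ∀ j → ι (q (σ ⟨$⟩ˡ j)) ≡ cols h j
      ιq j = trans (proj₁ (proj₂ (proj₂ (proj₂ (hit (σ ⟨$⟩ˡ j)))))) (cong (cols h) (inverseʳ σ))

  encoding : ∀ n → Encoding σ n (c ^ β)
  encoding zero    = record { encode = λ _ → zero ; injective = λ _ _ _ () }
  encoding (suc n) with j , n≤m , m≤nβ ← size-between n = record
    { encode    = λ M → inject≤ (E.encode (pad n≤m M)) fits
    ; injective = λ {M} {M′} av av′ eq → pad-injective n≤m
        (E.injective (av ∘ pad-hasPattern n≤m M) (av′ ∘ pad-hasPattern n≤m M′) (Fin.inject≤-injective fits fits _ _ eq))
    }
    where
    module E = Encoding (encoding-size j)
    fits : c ^ size j ≤ (c ^ β) ^ suc n
    fits = ℕ.≤-trans (ℕ.^-monoʳ-≤ c (ℕ.≤-trans m≤nβ (ℕ.≤-reflexive (ℕ.*-comm (suc n) β)))) (ℕ.≤-reflexive (sym (ℕ.^-*-assoc c β (suc n))))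

  encodings : ∃ λ c → ∀ n → Encoding σ n c
  encodings = c ^ β , encoding

-- Partitions as matrices

Same : Partition n → Fin n → Fin n → Set
Same P x y = Any (λ A → x ∈ A × y ∈ A) (parts P)

same? : (P : Partition n) (x y : Fin n) → Dec (Same P x y)
same? P x y = Any.any? (λ A → (x ∈? A) ×-dec (y ∈? A)) (parts P)

same-refl : (P : Partition n) (x : Fin n) → Same P x x
same-refl P x = Any.map (λ x∈A → x∈A , x∈A) (covers P x)

same-sym : (P : Partition n) {x y : Fin n} → Same P x y → Same P y x
same-sym P = Any.map swap

part-unique : {As : List (Subset n)} {A B : Subset n} {x : Fin n} → AllPairs Disjoint As →
  A List.∈ As → B List.∈ As → x ∈ A → x ∈ B → A ≡ B
part-unique (_ ∷ _) (here refl) (here refl) x∈A x∈B = refl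
part-unique (d ∷ _) (here refl) (there B∈)  x∈A x∈B = contradiction (_ , x∈p∩q⁺ (x∈A , x∈B)) (All.lookup d B∈)
part-unique (d ∷ _) (there A∈)  (here refl) x∈A x∈B = contradiction (_ , x∈p∩q⁺ (x∈B , x∈A)) (All.lookup d A∈)
part-unique (_ ∷ d) (there A∈)  (there B∈)  x∈A x∈B = part-unique d A∈ B∈ x∈A x∈B

same-trans : (P : Partition n) {x y z : Fin n} → Same P x y → Same P y z → Same P x z
same-trans P xy yz with A , A∈ , x∈A , y∈A ← find xy | B , B∈ , y∈B , z∈B ← find yz
  with refl ← part-unique (disjoint P) A∈ B∈ y∈A y∈B = lose A∈ (x∈A , z∈B)

same-part : (P : Partition n) {A : Subset n} {x y : Fin n} → A List.∈ parts P → x ∈ A → Same P x y → y ∈ A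
same-part P A∈ x∈A xy with B , B∈ , x∈B , y∈B ← find xy =
  subst (_ ∈_) (part-unique (disjoint P) B∈ A∈ x∈B x∈A) y∈B

-- A part is non-empty, hence it is the class of any of its elements and can be recovered from the
-- equivalence relation.
same⇒≈ : (P Q : Partition n) → (∀ x y → Same P x y ⇔ Same Q x y) → P ≈ Q
same⇒≈ P Q eq = mk⇔ (half P Q eq) (half Q P λ x y → ⇔-sym (eq x y))
  where
  half : (P Q : Partition n) → (∀ x y → Same P x y ⇔ Same Q x y) → ∀ {A} → A List.∈ parts P → A List.∈ parts Q
  half P Q eq {A} A∈P with x , x∈A ← All.lookup (nonempty P) A∈P
    with B , B∈Q , x∈B ← find (covers Q x) = subst (List._∈ parts Q) (⊆-antisym B⊆A A⊆B) B∈Q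
    where
    B⊆A : ∀ {y} → y ∈ B → y ∈ A
    B⊆A y∈B = same-part P A∈P x∈A (from (eq _ _) (lose B∈Q (x∈B , y∈B)))
    A⊆B : ∀ {y} → y ∈ A → y ∈ B
    A⊆B y∈A = same-part Q B∈Q x∈B (to (eq _ _) (lose A∈P (x∈A , y∈A)))

≈⇒same : (P Q : Partition n) → P ≈ Q → ∀ {x y} → Same P x y → Same Q x y
≈⇒same P Q P≈Q xy with A , A∈P , xy∈A ← find xy = lose (to P≈Q A∈P) xy∈A

≈-sym : (P Q : Partition n) → P ≈ Q → Q ≈ P
≈-sym P Q P≈Q = ⇔-sym P≈Q

≈-trans : (P Q R : Partition n) → P ≈ Q → Q ≈ R → P ≈ R
≈-trans P Q R P≈Q Q≈R = Q≈R ⇔-∘ P≈Q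

same-induced : (s : Fin k → Fin n) (P : Partition n) (x y : Fin k) →
  Same (induced s P) x y ⇔ Same P (s x) (s y)
same-induced s P x y = mk⇔ there′ back
  where
  there′ : Same (induced s P) x y → Same P (s x) (s y)
  there′ xy with B , B∈ , x∈B , y∈B ← find xy
    with A , A∈P , refl ← Mem.∈-map⁻ (preimage s) (proj₁ (Mem.∈-filter⁻ nonempty? B∈)) =
    lose A∈P (∈-preimage⁻ s A x∈B , ∈-preimage⁻ s A y∈B)
  back : Same P (s x) (s y) → Same (induced s P) x y
  back xy with A , A∈P , x∈A , y∈A ← find xy =
    let x∈B = ∈-preimage⁺ s A x∈A
    in lose (Mem.∈-filter⁺ nonempty? (Mem.∈-map⁺ (preimage s) A∈P) (x , x∈B)) (x∈B , ∈-preimage⁺ s A y∈A)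

-- The parts are the fibres of `f`. Under `induced s` a labelling is just composed with `s`, which
-- replaces work with lists of parts.
Labelling : {A : Set} → Partition n → (Fin n → A) → Set
Labelling P f = ∀ x y → Same P x y ⇔ f x ≡ f y

labelling-≈ : {A B : Set} {f : Fin n → A} {g : Fin n → B} (P Q : Partition n) → Labelling P f → Labelling Q g →
  (∀ x y → f x ≡ f y ⇔ g x ≡ g y) → P ≈ Q
labelling-≈ P Q Pf Qg fg = same⇒≈ P Q λ x y → ⇔-sym (Qg x y) ⇔-∘ (fg x y ⇔-∘ Pf x y)

labelling-induced : {A : Set} {f : Fin n → A} (s : Fin k → Fin n) (P : Partition n) →
  Labelling P f → Labelling (induced s P) (f ∘ s)
labelling-induced s P Pf x y = Pf (s x) (s y) ⇔-∘ same-induced s P x y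

-- The `i` for which `pair π i` is the part of `x` in `H π`.
pairIndex : Permutation′ k → Fin (k + k) → Fin k
pairIndex {k} π x = [ id , π ⟨$⟩ˡ_ ]′ (splitAt k x)

pairIndex-↑ˡ : (π : Permutation′ k) (i : Fin k) → pairIndex π (i ↑ˡ k) ≡ i
pairIndex-↑ˡ {k} π i = cong [ id , π ⟨$⟩ˡ_ ]′ (Fin.splitAt-↑ˡ k i k)

pairIndex-↑ʳ : (π : Permutation′ k) (j : Fin k) → pairIndex π (k ↑ʳ j) ≡ π ⟨$⟩ˡ j
pairIndex-↑ʳ {k} π j = cong [ id , π ⟨$⟩ˡ_ ]′ (Fin.splitAt-↑ʳ k k j)

∈-pair⇔ : (π : Permutation′ k) (i : Fin k) (x : Fin (k + k)) → x ∈ pair π i ⇔ pairIndex π x ≡ i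
∈-pair⇔ {k} π i x = mk⇔ there′ back
  where
  there′ : x ∈ pair π i → pairIndex π x ≡ i
  there′ x∈ with x∈p∪q⁻ _ _ x∈
  ... | inj₁ p with refl ← x∈⁅y⁆⇒x≡y _ p = pairIndex-↑ˡ π i
  ... | inj₂ p with refl ← x∈⁅y⁆⇒x≡y _ p = trans (pairIndex-↑ʳ π (π ⟨$⟩ʳ i)) (inverseˡ π)
  back : pairIndex π x ≡ i → x ∈ pair π i
  back eq with splitAt k x in split
  ... | inj₁ i′ with refl ← eq | refl ← Fin.splitAt⁻¹-↑ˡ split = x∈p∪q⁺ (inj₁ (x∈⁅x⁆ _))
  ... | inj₂ j  with refl ← eq | refl ← Fin.splitAt⁻¹-↑ʳ split =
    x∈p∪q⁺ (inj₂ (subst (λ j′ → k ↑ʳ j ∈ ⁅ k ↑ʳ j′ ⁆) (sym (inverseʳ π)) (x∈⁅x⁆ _)))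

labelling-H : (π : Permutation′ k) → Labelling (H π) (pairIndex π)
labelling-H π x y = mk⇔
  (λ xy → let i , x∈ , y∈ = Any.tabulate⁻ {P = λ A → x ∈ A × y ∈ A} {f = pair π} xy in
           trans (to (∈-pair⇔ π i x) x∈) (sym (to (∈-pair⇔ π i y) y∈)))
  (λ eq → Any.tabulate⁺ {P = λ A → x ∈ A × y ∈ A} {f = pair π} (pairIndex π y)
           (from (∈-pair⇔ π _ x) eq , from (∈-pair⇔ π _ y) refl))

-- Minima of parts and the pattern that yields `H π`

least : {R : Fin n → Set} → Decidable R → ∃ R → ∃ λ i → R i × (∀ j → R j → i Fin.≤ j)
least {suc n} {R} R? (i , Ri) with R? zero | i
... | yes R0 | _     = zero , R0 , λ _ _ → z≤n
... | no ¬R0 | zero  = contradiction Ri ¬R0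
... | no ¬R0 | suc i with i′ , Ri′ , minimal ← least (R? ∘ suc) (i , Ri) =
      suc i′ , Ri′ , λ { zero R0 → contradiction R0 ¬R0 ; (suc j) Rj → s≤s (minimal j Rj) }

module _ (P : Partition n) where

  private
    first : ∀ x → ∃ λ i → Same P i x × (∀ j → Same P j x → i Fin.≤ j)
    first x = least (λ y → same? P y x) (x , same-refl P x)

  minimum : Fin n → Fin n
  minimum x = proj₁ (first x)

  minimum-same : ∀ x → Same P (minimum x) x
  minimum-same x = proj₁ (proj₂ (first x))

  minimum-least : ∀ {x y} → Same P y x → minimum x Fin.≤ y
  minimum-least {x} {y} = proj₂ (proj₂ (first x)) y

  minimum-≤ : ∀ x → minimum x Fin.≤ x
  minimum-≤ x = minimum-least (same-refl P x)

  minimum-cong : ∀ {x y} → Same P x y → minimum x ≡ minimum y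
  minimum-cong {x} {y} xy = Fin.≤-antisym
    (minimum-least (same-trans P (minimum-same y) (same-sym P xy)))
    (minimum-least (same-trans P (minimum-same x) xy))

  minimum-idem : ∀ x → minimum (minimum x) ≡ minimum x
  minimum-idem x = minimum-cong (minimum-same x)

  labelling-minimum : Labelling P minimum
  labelling-minimum x y = mk⇔ minimum-cong λ eq →
    same-trans P (same-sym P (minimum-same x)) (subst (λ z → Same P z y) (sym eq) (minimum-same y))

  minimumMatrix : Matrix n
  minimumMatrix i j = does (i Fin.≟ minimum j)

-- The only one of column `x` is in row `minimum P x`, so the matrix determines the minima, and
-- these label the parts.
minimumMatrix-injective : (P Q : Partition n) → minimumMatrix P ≗₂ minimumMatrix Q → P ≈ Q
minimumMatrix-injective P Q eq = labelling-≈ P Q (labelling-minimum P) (labelling-minimum Q) λ x y →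
  mk⇔ (λ e → trans (sym (agree x)) (trans e (agree y))) (λ e → trans (agree x) (trans e (sym (agree y))))
  where
  agree : ∀ x → minimum P x ≡ minimum Q x
  agree x = does⁻ (minimum P x Fin.≟ minimum Q x)
    (trans (sym (eq (minimum P x) x)) (dec-true (minimum P x Fin.≟ minimum P x) refl))

infixr 5 _⊹_
_⊹_ : {A : Set} → (Fin k → A) → (Fin l → A) → Fin (k + l) → A
_⊹_ {k} f g x = [ f , g ]′ (splitAt k x)

⊹-↑ˡ : {A : Set} (f : Fin k → A) (g : Fin l → A) (i : Fin k) → (f ⊹ g) (i ↑ˡ l) ≡ f i
⊹-↑ˡ {k} {l} f g i = cong [ f , g ]′ (Fin.splitAt-↑ˡ k i l)

⊹-↑ʳ : {A : Set} (f : Fin k → A) (g : Fin l → A) (j : Fin l) → (f ⊹ g) (k ↑ʳ j) ≡ g j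
⊹-↑ʳ {k} {l} f g j = cong [ f , g ]′ (Fin.splitAt-↑ʳ k l j)

⊹-mono : {f : Fin k → Fin n} {g : Fin l → Fin n} → StrictlyMonotone f → StrictlyMonotone g →
  (∀ i j → f i Fin.< g j) → StrictlyMonotone (f ⊹ g)
⊹-mono {k} {l = l} {f = f} {g} f-mono g-mono f<g {x} {y} x<y with splitAt k x in eqx | splitAt k y in eqy
... | inj₁ i | inj₁ i′ with refl ← Fin.splitAt⁻¹-↑ˡ eqx | refl ← Fin.splitAt⁻¹-↑ˡ eqy =
      f-mono (≡.subst₂ _<_ (Fin.toℕ-↑ˡ i l) (Fin.toℕ-↑ˡ i′ l) x<y)
... | inj₁ i | inj₂ j′ = f<g i j′
... | inj₂ j | inj₂ j′ with refl ← Fin.splitAt⁻¹-↑ʳ eqx | refl ← Fin.splitAt⁻¹-↑ʳ eqy =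
      g-mono (ℕ.+-cancelˡ-< k _ _ (≡.subst₂ _<_ (Fin.toℕ-↑ʳ k j) (Fin.toℕ-↑ʳ k j′) x<y))
... | inj₂ j | inj₁ i′ with refl ← Fin.splitAt⁻¹-↑ʳ eqx | refl ← Fin.splitAt⁻¹-↑ˡ eqy =
      contradiction (ℕ.<-trans x<y (ℕ.≤-trans (s≤s (ℕ.≤-reflexive (Fin.toℕ-↑ˡ i′ l)))
        (ℕ.≤-trans (Fin.toℕ<n i′) (ℕ.≤-trans (ℕ.m≤m+n k (toℕ j)) (ℕ.≤-reflexive (sym (Fin.toℕ-↑ʳ k j))))))) (ℕ.<-irrefl refl)

strictlyMonotone⇒monotone : {f : Fin m → Fin n} → StrictlyMonotone f → f Preserves Fin._≤_ ⟶ Fin._≤_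
strictlyMonotone⇒monotone {f = f} f-mono i≤j with ℕ.m≤n⇒m<n∨m≡n i≤j
... | inj₁ i<j = ℕ.<⇒≤ (f-mono i<j)
... | inj₂ i≡j = ℕ.≤-reflexive (cong (toℕ ∘ f) (Fin.toℕ-injective i≡j))

mono-injective : {f : Fin m → Fin n} → StrictlyMonotone f → ∀ {i j} → f i ≡ f j → i ≡ j
mono-injective f-mono {i} {j} eq with Fin.<-cmp i j
... | tri< i<j _ _ = contradiction eq (Fin.<⇒≢ (f-mono i<j))
... | tri≈ _ i≡j _ = i≡j
... | tri> _ _ j<i = contradiction (sym eq) (Fin.<⇒≢ (f-mono j<i))

punchIn-mono-< : ∀ (i : Fin (suc n)) → StrictlyMonotone (punchIn i)
punchIn-mono-< i {j} {k} j<k = Fin.≤∧≢⇒< (Fin.punchIn-mono-≤ i j k (ℕ.<⇒≤ j<k)) (Fin.<⇒≢ j<k ∘ Fin.punchIn-injective i j k)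

insert-self : ∀ (i j : Fin (suc n)) (π : Permutation′ n) → insert i j π ⟨$⟩ʳ i ≡ j
insert-self i j π with i Fin.≟ i
... | yes _  = refl
... | no i≢i = contradiction refl i≢i

-- The extra last row, with its entry in an extra first column, forces
-- the rows of the remaining entries to precede their columns.
extend : Permutation′ k → Permutation′ (suc k)
extend {k} π = insert (Fin.fromℕ k) zero π

-- `s` lists the rows other than the last and then the columns other than the first. A row with a
-- one is the minimum of its own part, and the minimum of a column is the row of its one. So
-- `minimum P` along `s` is the injective `r` after `pairIndex π`, which labels `H π`.
pattern⇒H : (π : Permutation′ k) (P : Partition n) → HasPattern (extend π) (minimumMatrix P) →
  ∃ λ s → StrictlyMonotone s × induced s P ≈ H π
pattern⇒H {k} {n} π P h = s , s-mono , labelling-≈ (induced s P) (H π) (labelling-induced s P (labelling-minimum P)) (labelling-H π)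
  λ x y → mk⇔ (λ e → r-injective (trans (sym (minimum-s x)) (trans e (minimum-s y))))
              (λ e → trans (minimum-s x) (trans (cong r e) (sym (minimum-s y))))
  where
  last = Fin.fromℕ k
  r c : Fin k → Fin n
  r i = rows h (punchIn last i)
  c j = cols h (suc j)

  s : Fin (k + k) → Fin n
  s = r ⊹ c

  r-c : ∀ i → r i ≡ minimum P (c (π ⟨$⟩ʳ i))
  r-c i = trans (does⁻ (r i Fin.≟ _) (entry h (punchIn last i)))
                (cong (minimum P ∘ cols h) (insert-punchIn last zero π i))

  r-c′ : ∀ j → minimum P (c j) ≡ r (π ⟨$⟩ˡ j)
  r-c′ j = trans (cong (minimum P ∘ c) (sym (inverseʳ π))) (sym (r-c (π ⟨$⟩ˡ j)))

  r-fixed : ∀ i → minimum P (r i) ≡ r i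
  r-fixed i = trans (cong (minimum P) (r-c i)) (trans (minimum-idem P _) (sym (r-c i)))

  r-mono : StrictlyMonotone r
  r-mono i<j = rows-mono h (punchIn-mono-< last i<j)

  r-injective : ∀ {i j} → r i ≡ r j → i ≡ j
  r-injective = mono-injective r-mono

  -- The added entry says that the last row is the minimum of the part of the first column. The rows
  -- `r` precede the former and the columns `c` follow the latter.
  last≤first : rows h last Fin.≤ cols h zero
  last≤first = ≡.subst₂ Fin._≤_
    (sym (does⁻ (rows h last Fin.≟ _) (entry h last))) (cong (cols h) (insert-self last zero π))
    (minimum-≤ P (cols h (extend π ⟨$⟩ʳ last)))

  r<c : ∀ i j → r i Fin.< c j
  r<c i j = ℕ.<-trans (rows-mono h (Fin.≤∧≢⇒< (Fin.≤fromℕ _) (Fin.punchInᵢ≢i last i)))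
                      (ℕ.≤-<-trans last≤first (cols-mono h (s≤s z≤n)))

  s-mono : StrictlyMonotone s
  s-mono = ⊹-mono r-mono (λ i<j → cols-mono h (s<s i<j)) r<c

  minimum-s : ∀ x → minimum P (s x) ≡ r (pairIndex π x)
  minimum-s x with splitAt k x
  ... | inj₁ i = r-fixed i
  ... | inj₂ j = r-c′ j

-- Searching for a pattern

-- Functions are searched through their codes in `Fin (n ^ m)`. Decoding returns a function only up
-- to pointwise equality, so `R` has to respect it.
function-any? : {R : (Fin m → Fin n) → Set} → (∀ {f g} → f ≗ g → R f → R g) → Decidable R → Dec (∃ R)
function-any? resp R? = map′
  (λ (c , Rc) → finToFun c , Rc)
  (λ (f , Rf) → funToFin f , resp (sym ∘ Fin.finToFun-funToFin f) Rf)
  (Fin.any? (R? ∘ finToFun))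

strictlyMonotone? : Decidable (StrictlyMonotone {m} {n})
strictlyMonotone? f = map′ (λ mono → mono _ _) (λ mono i j → mono)
  (Fin.all? λ i → Fin.all? λ j → (i Fin.<? j) →-dec (f i Fin.<? f j))

strictlyMonotone-resp : {f g : Fin m → Fin n} → f ≗ g → StrictlyMonotone f → StrictlyMonotone g
strictlyMonotone-resp f≗g mono i<j = ≡.subst₂ Fin._<_ (f≗g _) (f≗g _) (mono i<j)

-- Makes the pigeonhole argument constructive: among finitely many listed partitions one with the
-- pattern is found by search.
hasPattern? : (σ : Permutation′ p) (M : Matrix n) → Dec (HasPattern σ M)
hasPattern? {p} {n} σ M = map′
  (λ (r , (r-mono , c , (c-mono , e))) → record { rows = r ; cols = c ; rows-mono = r-mono ; cols-mono = c-mono ; entry = e })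
  (λ h → rows h , ((λ {_} {_} → rows-mono h) , cols h , ((λ {_} {_} → cols-mono h) , entry h)))
  (function-any? with-rows-resp λ r → strictlyMonotone? r ×-dec function-any? (with-cols-resp r)
    λ c → strictlyMonotone? c ×-dec Fin.all? λ i → M (r i) (c (σ ⟨$⟩ʳ i)) Bool.≟ true)
  where
  WithCols : (r c : Fin p → Fin n) → Set
  WithCols r c = StrictlyMonotone c × (∀ i → M (r i) (c (σ ⟨$⟩ʳ i)) ≡ true)

  with-cols-resp : ∀ r {c c′} → c ≗ c′ → WithCols r c → WithCols r c′
  with-cols-resp r c≗ (c-mono , e) =
    strictlyMonotone-resp c≗ c-mono , λ i → subst (λ y → M (r i) y ≡ true) (c≗ (σ ⟨$⟩ʳ i)) (e i)

  with-rows-resp : ∀ {r r′} → r ≗ r′ → StrictlyMonotone r × ∃ (WithCols r) → StrictlyMonotone r′ × ∃ (WithCols r′)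
  with-rows-resp r≗ (r-mono , c , (c-mono , e)) = strictlyMonotone-resp r≗ r-mono ,
    c , (λ {_} {_} → c-mono) , λ i → subst (λ x → M x (c (σ ⟨$⟩ʳ i)) ≡ true) (r≗ i) (e i)

-- Exponential growth with natural bases

fromℕ : ℕ → ℚ
fromℕ m = ℤ.+ m / 1

toℚᵘ-fromℕ : ∀ m → toℚᵘ (fromℕ m) ℚᵘ.≃ mkℚᵘ (ℤ.+ m) 0
toℚᵘ-fromℕ m = ℚ.toℚᵘ-fromℚᵘ (mkℚᵘ (ℤ.+ m) 0)

fromℕ-homo-* : ∀ a b → fromℕ (a * b) ≡ fromℕ a ℚ.* fromℕ b
fromℕ-homo-* a b = ℚ.toℚᵘ-injective (begin
  toℚᵘ (fromℕ (a * b))                  ≈⟨ toℚᵘ-fromℕ (a * b) ⟩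
  mkℚᵘ (ℤ.+ (a * b)) 0                    ≡⟨ cong (λ i → mkℚᵘ i 0) (ℤ.pos-* a b) ⟩
  mkℚᵘ (ℤ.+ a) 0 ℚᵘ.* mkℚᵘ (ℤ.+ b) 0        ≈⟨ ℚᵘ.*-cong (toℚᵘ-fromℕ a) (toℚᵘ-fromℕ b) ⟨
  toℚᵘ (fromℕ a) ℚᵘ.* toℚᵘ (fromℕ b)    ≈⟨ ℚ.toℚᵘ-homo-* (fromℕ a) (fromℕ b) ⟨
  toℚᵘ (fromℕ a ℚ.* fromℕ b)            ∎)
  where open import Relation.Binary.Reasoning.Setoid ℚᵘ.≃-setoid

fromℕ-homo-^ : ∀ a n → fromℕ (a ^ n) ≡ fromℕ a ^ℚ n
fromℕ-homo-^ a zero    = refl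
fromℕ-homo-^ a (suc n) = trans (fromℕ-homo-* a (a ^ n)) (cong (fromℕ a ℚ.*_) (fromℕ-homo-^ a n))

fromℕ-mono-< : ∀ {a b} → a < b → fromℕ a ℚ.< fromℕ b
fromℕ-mono-< {a} {b} a<b = ℚ.toℚᵘ-cancel-< (ℚᵘ.<-respˡ-≃ (ℚᵘ.≃-sym (toℚᵘ-fromℕ a)) (ℚᵘ.<-respʳ-≃ (ℚᵘ.≃-sym (toℚᵘ-fromℕ b))
  (*<* (ℤ.*-monoʳ-<-pos (ℤ.+ 1) (ℤ.+<+ a<b)))))

fromℕ-cancel-< : ∀ {a b} → fromℕ a ℚ.< fromℕ b → a < b
fromℕ-cancel-< {a} {b} a<b
  with *<* lt ← ℚᵘ.<-respˡ-≃ (toℚᵘ-fromℕ a) (ℚᵘ.<-respʳ-≃ (toℚᵘ-fromℕ b) (ℚ.toℚᵘ-mono-< a<b)) =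
  ℤ.drop‿+<+ (ℤ.*-cancelʳ-<-nonNeg (ℤ.+ 1) lt)

fromℕ-nonNeg : ∀ m → NonNegative (fromℕ m)
fromℕ-nonNeg m = ℚ.normalize-nonNeg m 1

≤fromℕ : (c : ℚ) .{{_ : Positive c}} → ∃ λ a → c ℚ.≤ fromℕ a
≤fromℕ (mkℚ +[1+ a ] d _) = suc a , ℚ.toℚᵘ-cancel-≤ (ℚᵘ.≤-respʳ-≃ (ℚᵘ.≃-sym (toℚᵘ-fromℕ (suc a)))
  (*≤* (ℤ.*-monoˡ-≤-nonNeg +[1+ a ] (ℤ.+≤+ (s≤s z≤n)))))

^ℚ≤fromℕ : ∀ {c a} .{{_ : Positive c}} → c ℚ.≤ fromℕ a → ∀ n → c ^ℚ n ℚ.≤ fromℕ (a ^ n)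
^ℚ≤fromℕ c≤a zero    = ℚ.≤-refl
^ℚ≤fromℕ {c} {a} c≤a (suc n) = begin
  c ℚ.* c ^ℚ n                 ≤⟨ ℚ.*-monoˡ-≤-nonNeg c {{ℚ.pos⇒nonNeg c}} (^ℚ≤fromℕ c≤a n) ⟩
  c ℚ.* fromℕ (a ^ n)          ≤⟨ ℚ.*-monoʳ-≤-nonNeg (fromℕ (a ^ n)) {{fromℕ-nonNeg (a ^ n)}} c≤a ⟩
  fromℕ a ℚ.* fromℕ (a ^ n)    ≡⟨ fromℕ-homo-* a (a ^ n) ⟨
  fromℕ (a ^ suc n)            ∎
  where open ℚ.≤-Reasoning

-- Every positive rational base lies below a natural one.
superExponential⁺ : ∀ 𝒫 → (∀ a → ∃₂ λ N m → ∣ 𝒫 at N ∣≥ m × a ^ N < m) → SuperExponential 𝒫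
superExponential⁺ 𝒫 large c with a , c≤a ← ≤fromℕ c with N , m , inj , lt ← large a =
  N , m , inj , ℚ.≤-<-trans (^ℚ≤fromℕ c≤a N) (fromℕ-mono-< lt)

superExponential⁻ : ∀ 𝒫 → SuperExponential 𝒫 → ∀ a → ∃₂ λ N m → ∣ 𝒫 at N ∣≥ m × a ^ N < m
-- The base `suc a` is positive even when `a` is zero.
superExponential⁻ 𝒫 large a with N , m , inj , lt ← large (fromℕ (suc a)) {{ℚ.normalize-pos (suc a) 1}} =
  N , m , inj , ℕ.≤-<-trans (ℕ.^-monoˡ-≤ N (ℕ.n≤1+n a))
    (fromℕ-cancel-< (subst (ℚ._< fromℕ m) (sym (fromℕ-homo-^ (suc a) N)) lt))

-- Large hereditary properties contain every `H π`

module _ (𝒫 : Property) (hereditary : Hereditary 𝒫) (superexp : SuperExponential 𝒫) where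

  -- If the matrices of more than `c ^ N` distinct partitions all avoided `extend π`, their codes
  -- would be distinct elements of `Fin (c ^ N)`.
  contains-H-from : ∀ {k} (π : Permutation′ k) {c} → (∀ n → Encoding (extend π) n c) → 𝒫 ∋ H π
  contains-H-from π {c} E = large⇒ (superExponential⁻ 𝒫 superexp c)
    where
    large⇒ : (∃₂ λ N m → ∣ 𝒫 at N ∣≥ m × c ^ N < m) → 𝒫 ∋ H π
    large⇒ (N , m , inj , lt) = decide (Fin.any? (λ i → hasPattern? (extend π) (minimumMatrix (P i))))
      where
      module E = Encoding (E N)

      P : Fin m → Partition N
      P i = proj₁ (Injection.to inj i)

      decide : Dec (∃ λ i → HasPattern (extend π) (minimumMatrix (P i))) → 𝒫 ∋ H π
      decide (yes (i , pattern-i)) =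
        let s , s-mono , eq = pattern⇒H π (P i) pattern-i
        in Property.resp 𝒫 {P = induced s (P i)} {Q = H π} eq (hereditary (P i) s s-mono (proj₂ (Injection.to inj i)))
      decide (no none) = contradiction (Fin.injective⇒≤ code-injective) (ℕ.<⇒≱ lt)
        where
        code-injective : ∀ {i j} → E.encode (minimumMatrix (P i)) ≡ E.encode (minimumMatrix (P j)) → i ≡ j
        code-injective {i} {j} eq = Injection.injective inj
          (minimumMatrix-injective (P i) (P j) (E.injective (none ∘ (i ,_)) (none ∘ (j ,_)) eq))

  contains-H : ∀ k (π : Permutation′ k) → 𝒫 ∋ H π
  contains-H k π = contains-H-from π (proj₂ encodings)

-- Counting the partitions induced by the H π

-- Codes of the m-element subsets of [n].
Choice : ℕ → ℕ → Set
Choice n       zero    = ⊤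
Choice zero    (suc m) = ⊥
Choice (suc n) (suc m) = Choice n m ⊎ Choice n (suc m)

nC0≡1 : ∀ n → n C 0 ≡ 1
nC0≡1 n = trans (nCk≡nC[n∸k] {0} {n} z≤n) (nCn≡1 n)

Choice↔ : ∀ n m → Fin (n C m) ↔ Choice n m
Choice↔ n       zero    = Fin.1↔⊤ ↔-∘ cast-id (nC0≡1 n)
Choice↔ zero    (suc m) = Fin.0↔⊥ ↔-∘ cast-id (k>n⇒nCk≡0 {0} {suc m} (s≤s z≤n))
Choice↔ (suc n) (suc m) = (Choice↔ n m ⊎-↔ Choice↔ n (suc m)) ↔-∘ (Fin.+↔⊎ ↔-∘ cast-id (sym (nCk+nC[k+1]≡[n+1]C[k+1] n m)))

enumerate : Choice n m → Fin m → Fin n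
enumerate {suc n} {suc m} (inj₁ S) zero    = zero
enumerate {suc n} {suc m} (inj₁ S) (suc i) = suc (enumerate S i)
enumerate {suc n} {suc m} (inj₂ S) i       = suc (enumerate S i)

enumerate-mono : (S : Choice n m) → StrictlyMonotone (enumerate S)
enumerate-mono {suc n} {suc m} (inj₁ S) {zero}  {suc j} i<j = s≤s z≤n
enumerate-mono {suc n} {suc m} (inj₁ S) {suc i} {suc j} i<j = s<s (enumerate-mono S (s<s⁻¹ i<j))
enumerate-mono {suc n} {suc m} (inj₂ S) i<j = s<s (enumerate-mono S i<j)

enumerate-injective : (S T : Choice n m) → enumerate S ≗ enumerate T → S ≡ T
enumerate-injective {n}     {zero}  S        T        eq = refl
enumerate-injective {suc n} {suc m} (inj₁ S) (inj₁ T) eq = cong inj₁ (enumerate-injective S T (Fin.suc-injective ∘ eq ∘ suc))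
enumerate-injective {suc n} {suc m} (inj₁ S) (inj₂ T) eq = contradiction (eq zero) λ ()
enumerate-injective {suc n} {suc m} (inj₂ S) (inj₁ T) eq = contradiction (eq zero) λ ()
enumerate-injective {suc n} {suc m} (inj₂ S) (inj₂ T) eq = cong inj₂ (enumerate-injective S T (Fin.suc-injective ∘ eq))

predecessors : (f : Fin m → Fin (suc n)) → (∀ i → zero {n} Fin.< f i) → ∃ λ g → f ≗ suc ∘ g
predecessors f pos = proj₁ ∘ predecessor , proj₂ ∘ predecessor
  where
  predecessor : ∀ i → ∃ λ j → f i ≡ suc j
  predecessor i with f i | pos i
  ... | suc j | _ = j , refl

enumerate-surjective : (f : Fin m → Fin n) → StrictlyMonotone f → ∃ λ S → enumerate S ≗ f
enumerate-surjective {zero}          f mono = tt , λ ()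
enumerate-surjective {suc m} {zero}  f mono with () ← f zero
enumerate-surjective {suc m} {suc n} f mono with f zero in f0
-- The least value of `f` decides whether `zero` is chosen.
... | zero  =
  let g , f≗g   = predecessors (f ∘ suc) (λ i → subst (Fin._< f (suc i)) f0 (mono (s≤s z≤n)))
      S , S≗g   = enumerate-surjective g (λ i<j → s<s⁻¹ (≡.subst₂ Fin._<_ (f≗g _) (f≗g _) (mono (s<s i<j))))
  in inj₁ S , λ { zero → sym f0 ; (suc i) → trans (cong suc (S≗g i)) (sym (f≗g i)) }
... | suc _ =
  let g , f≗g   = predecessors f (λ { zero → subst (zero {n} Fin.<_) (sym f0) (s≤s z≤n)
                                    ; (suc i) → ℕ.≤-<-trans z≤n (mono {zero} {suc i} (s≤s z≤n)) })
      S , S≗g   = enumerate-surjective g (λ i<j → s<s⁻¹ (≡.subst₂ Fin._<_ (f≗g _) (f≗g _) (mono i<j)))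
  in inj₂ S , λ i → trans (cong suc (S≗g i)) (sym (f≗g i))

-- The image of `zero`, followed by a code for the permutation that remains when `zero` and its
-- image are removed.
PermutationCode : ℕ → Set
PermutationCode zero    = ⊤
PermutationCode (suc k) = Fin (suc k) × PermutationCode k

PermutationCode↔ : ∀ k → Fin (k !) ↔ PermutationCode k
PermutationCode↔ zero    = Fin.1↔⊤
PermutationCode↔ (suc k) = (↔-id _ ×-↔ PermutationCode↔ k) ↔-∘ Fin.*↔×

decode : PermutationCode k → Permutation′ k
decode {zero}  _       = Perm.id
decode {suc k} (i , c) = insert zero i (decode c)

decode-injective : (c d : PermutationCode k) → decode c Perm.≈ decode d → c ≡ d
decode-injective {zero}  c       d       eq = refl
decode-injective {suc k} (i , c) (j , d) eq
  with refl ← trans (sym (insert-self zero i (decode c))) (trans (eq zero) (insert-self zero j (decode d))) =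
  cong (i ,_) (decode-injective c d λ x → Fin.punchIn-injective i _ _
    (trans (sym (insert-punchIn zero i (decode c) x)) (trans (eq (suc x)) (insert-punchIn zero i (decode d) x))))

insert-cong : ∀ (i : Fin (suc k)) {π ρ : Permutation′ k} → π Perm.≈ ρ → insert zero i π Perm.≈ insert zero i ρ
insert-cong i {π} {ρ} π≈ρ zero    = trans (insert-self zero i π) (sym (insert-self zero i ρ))
insert-cong i {π} {ρ} π≈ρ (suc x) =
  trans (insert-punchIn zero i π x) (trans (cong (punchIn i) (π≈ρ x)) (sym (insert-punchIn zero i ρ x)))

decode-surjective : (π : Permutation′ k) → ∃ λ c → decode c Perm.≈ π
decode-surjective {zero}  π = tt , λ ()
decode-surjective {suc k} π with c , c≈ ← decode-surjective (remove zero π) =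
  (π ⟨$⟩ʳ zero , c) , λ x → trans (insert-cong (π ⟨$⟩ʳ zero) {decode c} {remove zero π} c≈ x) (insert-remove zero π x)

-- Indexing the summands of `bound`

boundTerm : ℕ → ℕ → ℕ
boundTerm n k = (n C (2 * k)) * k !

bound-applyUpTo : ∀ n → bound n ≡ listSum (applyUpTo (boundTerm n) (suc ⌊ n /2⌋))
bound-applyUpTo n = cong listSum (map-upTo (boundTerm n) (suc ⌊ n /2⌋))

-- Reads a sum as a disjoint union. The target allows any summand; the image consists of those with
-- number below `K`.
locate : (f : ℕ → ℕ) (K : ℕ) → Fin (listSum (applyUpTo f K)) → ∃ (Fin ∘ f)
locate f (suc K) x with splitAt (f 0) x
... | inj₁ i = 0 , i
... | inj₂ y = let k , i = locate (f ∘ suc) K y in suc k , i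

locate-injective : ∀ f K {x y} → locate f K x ≡ locate f K y → x ≡ y
locate-injective f (suc K) {x} {y} eq with splitAt (f 0) x in eqx | splitAt (f 0) y in eqy
... | inj₁ i | inj₁ j with refl ← eq = trans (sym (Fin.splitAt⁻¹-↑ˡ eqx)) (Fin.splitAt⁻¹-↑ˡ eqy)
... | inj₁ i | inj₂ v with () ← cong proj₁ eq
... | inj₂ u | inj₁ j with () ← cong proj₁ eq
... | inj₂ u | inj₂ v =
  trans (sym (Fin.splitAt⁻¹-↑ʳ eqx)) (trans (cong (f 0 ↑ʳ_) (locate-injective (f ∘ suc) K (unsuc eq))) (Fin.splitAt⁻¹-↑ʳ eqy))
  where
  unsuc : {p q : ∃ (Fin ∘ f ∘ suc)} → _≡_ {A = ∃ (Fin ∘ f)} (suc (proj₁ p) , proj₂ p) (suc (proj₁ q) , proj₂ q) → p ≡ q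
  unsuc refl = refl

locate-surjective : ∀ f K {k} → k < K → (i : Fin (f k)) → ∃ λ x → locate f K x ≡ (k , i)
locate-surjective f (suc K) {zero}  _   i = i ↑ˡ _ , found
  where
  found : locate f (suc K) (i ↑ˡ _) ≡ (0 , i)
  found rewrite Fin.splitAt-↑ˡ (f 0) i (listSum (applyUpTo (f ∘ suc) K)) = refl
locate-surjective f (suc K) {suc k} k<K i with x , eq ← locate-surjective (f ∘ suc) K (s<s⁻¹ k<K) i = f 0 ↑ʳ x , found
  where
  found : locate f (suc K) (f 0 ↑ʳ x) ≡ (suc k , i)
  found rewrite Fin.splitAt-↑ʳ (f 0) (listSum (applyUpTo (f ∘ suc) K)) x | eq = refl

-- No bound on `k` is recorded: a choice of `k + k` elements of `[n]` exists only for `k ≤ ⌊ n /2⌋`,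
-- the range of the sum in `bound n`.
Code : ℕ → Set
Code n = ∃ λ k → Choice n (k + k) × PermutationCode k

module _ (n : ℕ) where

  private
    term : ℕ → ℕ
    term = boundTerm n

    term↔ : ∀ k → Fin (term k) ↔ (Choice n (k + k) × PermutationCode k)
    term↔ k = ((Choice↔ n (k + k) ↔-∘ cast-id (cong (λ k′ → n C (k + k′)) (ℕ.+-identityʳ k))) ×-↔ PermutationCode↔ k) ↔-∘ Fin.*↔×

    fromTerm : ∃ (Fin ∘ term) → Code n
    fromTerm (k , i) = k , Inverse.to (term↔ k) i

    fromTerm-injective : ∀ {x y} → fromTerm x ≡ fromTerm y → x ≡ y
    fromTerm-injective {k , i} {k′ , i′} eq with refl ← cong proj₁ eq = cong (k ,_)
      (trans (sym (Inverse.strictlyInverseʳ (term↔ k) i))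
        (trans (cong (Inverse.from (term↔ k)) (snd eq)) (Inverse.strictlyInverseʳ (term↔ k) i′)))
      where
      snd : {p q : Choice n (k + k) × PermutationCode k} → _≡_ {A = Code n} (k , p) (k , q) → p ≡ q
      snd refl = refl

    choice⇒≤ : Choice n (k + k) → k ≤ ⌊ n /2⌋
    choice⇒≤ {k} S = subst (_≤ ⌊ n /2⌋) (sym (ℕ.n≡⌊n+n/2⌋ k))
      (ℕ.⌊n/2⌋-mono (Fin.injective⇒≤ (mono-injective (enumerate-mono S))))

  code : Fin (bound n) → Code n
  code x = fromTerm (locate term (suc ⌊ n /2⌋) (Fin.cast (bound-applyUpTo n) x))

  code-injective : ∀ {x y} → code x ≡ code y → x ≡ y
  code-injective {x} {y} eq = Fin.toℕ-injective (trans (sym (Fin.toℕ-cast (bound-applyUpTo n) x)) (trans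
    (cong toℕ (locate-injective term (suc ⌊ n /2⌋) (fromTerm-injective eq))) (Fin.toℕ-cast (bound-applyUpTo n) y)))

  code-surjective : (c : Code n) → ∃ λ x → code x ≡ c
  code-surjective (k , S , c)
    with x , eq ← locate-surjective term (suc ⌊ n /2⌋) (s≤s (choice⇒≤ S)) (Inverse.from (term↔ k) (S , c)) =
    Fin.cast (sym (bound-applyUpTo n)) x ,
    trans (cong (fromTerm ∘ locate term (suc ⌊ n /2⌋)) (Fin.cast-involutive (bound-applyUpTo n) (sym (bound-applyUpTo n)) x))
      (trans (cong fromTerm eq) (cong (k ,_) (Inverse.strictlyInverseˡ (term↔ k) (S , c))))

-- Partitions into pairs and singletons

↑ˡ<↑ʳ : (i : Fin k) (j : Fin l) → i ↑ˡ l Fin.< k ↑ʳ j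
↑ˡ<↑ʳ {k} {l} i j = ≡.subst₂ _<_ (sym (Fin.toℕ-↑ˡ i l)) (sym (Fin.toℕ-↑ʳ k j)) (ℕ.<-≤-trans (Fin.toℕ<n i) (ℕ.m≤m+n k (toℕ j)))

data Side : Fin (k + l) → Set where
  leftSide  : (i : Fin k) → Side {k} {l} (i ↑ˡ l)
  rightSide : (j : Fin l) → Side {k} {l} (k ↑ʳ j)

side : (z : Fin (k + l)) → Side {k} {l} z
side {k} z with splitAt k z in eq
... | inj₁ i with refl ← Fin.splitAt⁻¹-↑ˡ eq = leftSide i
... | inj₂ j with refl ← Fin.splitAt⁻¹-↑ʳ eq = rightSide j

-- Exchanges the two elements of each part of H π.
swapPairs : Permutation′ k → Fin (k + k) → Fin (k + k)
swapPairs {k} π = (λ i → k ↑ʳ (π ⟨$⟩ʳ i)) ⊹ (λ j → (π ⟨$⟩ˡ j) ↑ˡ k)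

module _ (π : Permutation′ k) where

  swapPairs-↑ˡ : ∀ i → swapPairs π (i ↑ˡ k) ≡ k ↑ʳ (π ⟨$⟩ʳ i)
  swapPairs-↑ˡ = ⊹-↑ˡ (λ i → k ↑ʳ (π ⟨$⟩ʳ i)) (λ j → (π ⟨$⟩ˡ j) ↑ˡ k)

  swapPairs-↑ʳ : ∀ j → swapPairs π (k ↑ʳ j) ≡ (π ⟨$⟩ˡ j) ↑ˡ k
  swapPairs-↑ʳ = ⊹-↑ʳ (λ i → k ↑ʳ (π ⟨$⟩ʳ i)) (λ j → (π ⟨$⟩ˡ j) ↑ˡ k)

  swapPairs-involutive : ∀ z → swapPairs π (swapPairs π z) ≡ z
  swapPairs-involutive z with side {k} {k} z
  ... | leftSide i  = trans (cong (swapPairs π) (swapPairs-↑ˡ i)) (trans (swapPairs-↑ʳ (π ⟨$⟩ʳ i)) (cong (_↑ˡ k) (inverseˡ π)))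
  ... | rightSide j = trans (cong (swapPairs π) (swapPairs-↑ʳ j)) (trans (swapPairs-↑ˡ (π ⟨$⟩ˡ j)) (cong (k ↑ʳ_) (inverseʳ π)))

  swapPairs-≢ : ∀ z → swapPairs π z ≢ z
  swapPairs-≢ z eq with side {k} {k} z
  ... | leftSide i  = Fin.<⇒≢ (↑ˡ<↑ʳ i (π ⟨$⟩ʳ i)) (trans (sym eq) (swapPairs-↑ˡ i))
  ... | rightSide j = Fin.<⇒≢ (↑ˡ<↑ʳ (π ⟨$⟩ˡ j) j) (trans (sym (swapPairs-↑ʳ j)) eq)

-- For injective `s`, the equivalence relation whose classes are the image under `s` of the parts of
-- `H π`, and singletons.
Matched : (Fin (k + k) → Fin n) → Permutation′ k → Fin n → Fin n → Set
Matched s π x y = x ≡ y ⊎ ∃ λ z → x ≡ s z × y ≡ s (swapPairs π z)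

matched-sym : (s : Fin (k + k) → Fin n) (π : Permutation′ k) {x y : Fin n} → Matched s π x y → Matched s π y x
matched-sym s π (inj₁ eq)             = inj₁ (sym eq)
matched-sym s π (inj₂ (z , xz , yz)) = inj₂ (swapPairs π z , yz , trans xz (cong s (sym (swapPairs-involutive π z))))

-- A record rather than a synonym, so that k can be inferred.
record Matching (P : Partition n) (s : Fin (k + k) → Fin n) (π : Permutation′ k) : Set where
  constructor matching
  field
    same⇔matched : ∀ x y → Same P x y ⇔ Matched s π x y

open Matching

matching-unique : (P Q : Partition n) {s : Fin (k + k) → Fin n} {π : Permutation′ k} →
  Matching P s π → Matching Q s π → P ≈ Q
matching-unique P Q mP mQ = same⇒≈ P Q λ x y → ⇔-sym (same⇔matched mQ x y) ⇔-∘ same⇔matched mP x y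

matching-≈ : (P Q : Partition n) {s : Fin (k + k) → Fin n} {π : Permutation′ k} → P ≈ Q → Matching P s π → Matching Q s π
matching-≈ P Q P≈Q mP = matching λ x y → mk⇔
  (to (same⇔matched mP x y) ∘ ≈⇒same Q P (≈-sym P Q P≈Q)) (≈⇒same P Q P≈Q ∘ from (same⇔matched mP x y))

matching-resp : (P : Partition n) {s s′ : Fin (k + k) → Fin n} {π π′ : Permutation′ k} →
  s ≗ s′ → π Perm.≈ π′ → Matching P s π → Matching P s′ π′
matching-resp {k = k} P {s} {s′} {π} {π′} s≗ π≈ mP = matching λ x y → mk⇔
  (rename π π′ s≗ swap≗ ∘ to (same⇔matched mP x y))
  (from (same⇔matched mP x y) ∘ rename π′ π (sym ∘ s≗) (sym ∘ swap≗))
  where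
  swap≗ : swapPairs π ≗ swapPairs π′
  swap≗ z with side {k} {k} z
  ... | leftSide i  = trans (swapPairs-↑ˡ π i) (trans (cong (k ↑ʳ_) (π≈ i)) (sym (swapPairs-↑ˡ π′ i)))
  ... | rightSide j = trans (swapPairs-↑ʳ π j) (trans (cong (_↑ˡ k) inverse≈) (sym (swapPairs-↑ʳ π′ j)))
    where
    inverse≈ : π ⟨$⟩ˡ j ≡ π′ ⟨$⟩ˡ j
    inverse≈ = trans (sym (inverseˡ π′)) (cong (π′ ⟨$⟩ˡ_) (trans (sym (π≈ (π ⟨$⟩ˡ j))) (inverseʳ π)))
  rename : ∀ {t t′ : Fin (k + k) → Fin _} (ρ ρ′ : Permutation′ k) {x y} →
    t ≗ t′ → swapPairs ρ ≗ swapPairs ρ′ → Matched t ρ x y → Matched t′ ρ′ x y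
  rename ρ ρ′ t≗ ρ≗ (inj₁ eq) = inj₁ eq
  rename {t′ = t′} ρ ρ′ t≗ ρ≗ (inj₂ (z , xz , yz)) = inj₂ (z , trans xz (t≗ z) , trans yz (trans (t≗ _) (cong t′ (ρ≗ z))))

-- A strictly increasing map dominates the identity, so two strictly
-- increasing enumerations of the same set agree.
toℕ≤mono : {f : Fin m → Fin n} → StrictlyMonotone f → ∀ i → toℕ i ≤ toℕ (f i)
toℕ≤mono f-mono zero = z≤n
toℕ≤mono {suc m} {f = f} f-mono (suc i) = ℕ.≤-<-trans
  (toℕ≤mono {f = f ∘ Fin.inject₁} (λ i<j → f-mono (≡.subst₂ _<_ (sym (Fin.toℕ-inject₁ _)) (sym (Fin.toℕ-inject₁ _)) i<j)) i)
  (f-mono (s≤s (ℕ.≤-reflexive (Fin.toℕ-inject₁ i))))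

mono-factor : {s : Fin k → Fin n} {s′ : Fin l → Fin n} {h : Fin k → Fin l} →
  StrictlyMonotone s → StrictlyMonotone s′ → (∀ z → s z ≡ s′ (h z)) → StrictlyMonotone h
mono-factor {s′ = s′} {h} s-mono s′-mono s≗ {i} {j} i<j with h i Fin.<? h j
... | yes hi<hj = hi<hj
... | no  hi≮hj =
  contradiction (≡.subst₂ Fin._<_ (s≗ i) (s≗ j) (s-mono i<j)) (ℕ.≤⇒≯ (strictlyMonotone⇒monotone s′-mono (ℕ.≮⇒≥ hi≮hj)))

module _ {s : Fin k → Fin n} {s′ : Fin l → Fin n} (s-mono : StrictlyMonotone s) (s′-mono : StrictlyMonotone s′)
         {h : Fin k → Fin l} {h′ : Fin l → Fin k} (s≗ : ∀ z → s z ≡ s′ (h z)) (s′≗ : ∀ z → s′ z ≡ s (h′ z)) where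

  enumerations-same-size : k ≡ l
  enumerations-same-size = ℕ.≤-antisym (Fin.injective⇒≤ (mono-injective (mono-factor s-mono s′-mono s≗)))
                                       (Fin.injective⇒≤ (mono-injective (mono-factor s′-mono s-mono s′≗)))

  enumerations-agree : ∀ z → toℕ (h z) ≡ toℕ z
  enumerations-agree z = ℕ.≤-antisym
    (ℕ.≤-trans (toℕ≤mono (mono-factor s′-mono s-mono s′≗) (h z))
               (ℕ.≤-reflexive (cong toℕ (mono-injective s-mono (sym (trans (s≗ z) (s′≗ (h z))))))))
    (toℕ≤mono (mono-factor s-mono s′-mono s≗) z)

module _ (P : Partition n) {s : Fin (k + k) → Fin n} {s′ : Fin (l + l) → Fin n} {π : Permutation′ k} {π′ : Permutation′ l}
         (s-mono : StrictlyMonotone s) (mP : Matching P s π) (mP′ : Matching P s′ π′) where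

  -- `swapPairs` moves every point and `s` is injective, so a pair of `s` is two distinct elements
  -- of one part, which must be a pair of `s′`.
  transfer : ∀ z → ∃ λ z′ → s z ≡ s′ z′ × s (swapPairs π z) ≡ s′ (swapPairs π′ z′)
  transfer z with to (same⇔matched mP′ _ _) (from (same⇔matched mP _ _) (inj₂ (z , refl , refl)))
  ... | inj₁ eq    = contradiction (sym (mono-injective s-mono eq)) (swapPairs-≢ π z)
  ... | inj₂ found = found

k+k-injective : k + k ≡ l + l → k ≡ l
k+k-injective {k} {l} eq = trans (ℕ.n≡⌊n+n/2⌋ k) (trans (cong ⌊_/2⌋ eq) (sym (ℕ.n≡⌊n+n/2⌋ l)))

matching-size : (P : Partition n)
  {s : Fin (k + k) → Fin n} {s′ : Fin (l + l) → Fin n} {π : Permutation′ k} {π′ : Permutation′ l} →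
  StrictlyMonotone s → StrictlyMonotone s′ → Matching P s π → Matching P s′ π′ →
  k ≡ l
matching-size P s-mono s′-mono mP mP′ = k+k-injective (enumerations-same-size s-mono s′-mono
  (proj₁ ∘ proj₂ ∘ transfer P s-mono mP mP′) (proj₁ ∘ proj₂ ∘ transfer P s′-mono mP′ mP))

-- The paired elements are determined by `P`, so `s` and `s′` enumerate the same set; then `π` is
-- read off from the partners of the first `k` of them.
matching-data-unique : (P : Partition n) {s s′ : Fin (k + k) → Fin n} {π π′ : Permutation′ k} →
  StrictlyMonotone s → StrictlyMonotone s′ → Matching P s π → Matching P s′ π′ → s ≗ s′ × π Perm.≈ π′
matching-data-unique {k = k} P {s} {s′} {π} {π′} s-mono s′-mono mP mP′ = (λ z → trans (h-s z) (cong s′ (h-id z))) ,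
  λ i → Fin.↑ʳ-injective k _ _ (trans (sym (swapPairs-↑ˡ π i)) (trans (mono-injective s′-mono (swap-agree (i ↑ˡ k))) (swapPairs-↑ˡ π′ i)))
  where
  h = λ z → proj₁ (transfer P s-mono mP mP′ z)
  h-s : ∀ z → s z ≡ s′ (h z)
  h-s z = proj₁ (proj₂ (transfer P s-mono mP mP′ z))
  h-id : ∀ z → h z ≡ z
  h-id z = Fin.toℕ-injective (enumerations-agree s-mono s′-mono {h} {λ z → proj₁ (transfer P s′-mono mP′ mP z)} h-s
    (proj₁ ∘ proj₂ ∘ transfer P s′-mono mP′ mP) z)
  swap-agree : ∀ z → s′ (swapPairs π z) ≡ s′ (swapPairs π′ z)
  swap-agree z = trans (sym (trans (h-s (swapPairs π z)) (cong s′ (h-id (swapPairs π z)))))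
    (trans (proj₂ (proj₂ (transfer P s-mono mP mP′ z))) (cong (s′ ∘ swapPairs π′) (h-id z)))

module _ {s : Fin (k + k) → Fin n} (s-mono : StrictlyMonotone s) (π : Permutation′ k) where

  private
    hit? : ∀ x → Dec (∃ λ z → s z ≡ x)
    hit? x = Fin.any? λ z → s z Fin.≟ x

    τ = swapPairs π

  -- The involution of `[n]` that exchanges the elements of each pair and fixes the rest.
  partner : Fin n → Fin n
  partner x with hit? x
  ... | yes (z , _) = s (τ z)
  ... | no  _       = x

  partner-hit : ∀ z → partner (s z) ≡ s (τ z)
  partner-hit z with hit? (s z)
  ... | yes (z′ , eq) = cong (s ∘ τ) (mono-injective s-mono eq)
  ... | no  none      = contradiction (z , refl) none

  partner-cases : ∀ x → (∃ λ z → x ≡ s z × partner x ≡ s (τ z)) ⊎ partner x ≡ x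
  partner-cases x with hit? x
  ... | yes (z , eq) = inj₁ (z , sym eq , refl)
  ... | no  _        = inj₂ refl

  partner-involutive : ∀ x → partner (partner x) ≡ x
  partner-involutive x with partner-cases x
  ... | inj₁ (z , refl , _) = trans (cong partner (partner-hit z)) (trans (partner-hit (τ z)) (cong s (swapPairs-involutive π z)))
  ... | inj₂ fixed = trans (cong partner fixed) fixed

  matched-partner : ∀ x → Matched s π x (partner x)
  matched-partner x with partner-cases x
  ... | inj₁ found = inj₂ found
  ... | inj₂ fixed = inj₁ (sym fixed)

  partnerPermutation : Permutation′ n
  partnerPermutation = permutation partner partner partner-involutive partner-involutive

  private
    -- Everything up to the last lower element of a pair; this puts all upper elements on the other
    -- side.
    Left : Fin n → Set
    Left x = ∃ λ (i : Fin k) → x Fin.≤ s (i ↑ˡ k)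

    left? : Decidable Left
    left? x = Fin.any? λ i → x Fin.≤? s (i ↑ˡ k)

    ¬left-↑ʳ : ∀ j → ¬ Left (s (k ↑ʳ j))
    ¬left-↑ʳ j (i , le) = ℕ.<⇒≱ (s-mono (↑ˡ<↑ʳ i j)) le

  place : Fin n → Fin (n + n)
  place x with left? x
  ... | yes _ = x ↑ˡ n
  ... | no  _ = n ↑ʳ x

  place-mono : StrictlyMonotone place
  place-mono {x} {y} x<y with left? x | left? y
  ... | yes _ | yes _ = ≡.subst₂ _<_ (sym (Fin.toℕ-↑ˡ x n)) (sym (Fin.toℕ-↑ˡ y n)) x<y
  ... | yes _ | no  _ = ↑ˡ<↑ʳ x y
  ... | no ¬x | yes (i , y≤) = contradiction (i , ℕ.≤-trans (ℕ.<⇒≤ x<y) y≤) ¬x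
  ... | no  _ | no  _ = ≡.subst₂ _<_ (sym (Fin.toℕ-↑ʳ n x)) (sym (Fin.toℕ-↑ʳ n y)) (ℕ.+-monoʳ-< n x<y)

  -- Two copies of `[n]` are matched along `partner`, and `place` picks the lower copy of each left
  -- element and the upper copy of each right one. An unpaired element is matched with its own other
  -- copy, which is not picked, and so becomes a singleton. In this form membership in `𝓜` is
  -- immediate.
  matchingPartition : Partition n
  matchingPartition = induced place (H partnerPermutation)

  private
    label : Fin n → Fin n
    label x = pairIndex partnerPermutation (place x)

    label-left : ∀ {x} → Left x → label x ≡ x
    label-left {x} lx with left? x
    ... | yes _  = pairIndex-↑ˡ partnerPermutation x
    ... | no ¬lx = contradiction lx ¬lx

    label-right : ∀ {x} → ¬ Left x → label x ≡ partner x
    label-right {x} ¬lx with left? x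
    ... | yes lx = contradiction lx ¬lx
    ... | no  _  = pairIndex-↑ʳ partnerPermutation x

    label-swap : ∀ z → label (s z) ≡ label (s (τ z))
    label-swap z with side {k} {k} z
    ... | leftSide i  = trans (label-left (i , ℕ.≤-refl)) (sym (trans (cong (label ∘ s) (swapPairs-↑ˡ π i))
          (trans (label-right (¬left-↑ʳ (π ⟨$⟩ʳ i))) (trans (partner-hit _)
            (cong s (trans (swapPairs-↑ʳ π (π ⟨$⟩ʳ i)) (cong (_↑ˡ k) (inverseˡ π))))))))
    ... | rightSide j = trans (label-right (¬left-↑ʳ j)) (trans (partner-hit _) (trans (cong s (swapPairs-↑ʳ π j))
          (sym (trans (cong (label ∘ s) (swapPairs-↑ʳ π j)) (label-left (π ⟨$⟩ˡ j , ℕ.≤-refl))))))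

    label-matched : ∀ {x y} → label x ≡ label y → Matched s π x y
    label-matched {x} {y} eq = cases (left? x) (left? y)
      where
      cases : Dec (Left x) → Dec (Left y) → Matched s π x y
      cases (yes lx) (yes ly) = inj₁ (trans (sym (label-left lx)) (trans eq (label-left ly)))
      cases (yes lx) (no ¬ly) = subst (λ x → Matched s π x y) (sym (trans (sym (label-left lx)) (trans eq (label-right ¬ly))))
                                  (matched-sym s π (matched-partner y))
      cases (no ¬lx) (yes ly) = subst (Matched s π x) (trans (sym (label-right ¬lx)) (trans eq (label-left ly))) (matched-partner x)
      cases (no ¬lx) (no ¬ly) = inj₁ (trans (sym (partner-involutive x))
        (trans (cong partner (trans (sym (label-right ¬lx)) (trans eq (label-right ¬ly)))) (partner-involutive y)))

  matchingPartition-matching : Matching matchingPartition s π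
  matchingPartition-matching = matching λ x y → mk⇔
    (λ xy → label-matched (to (labelled x y) xy))
    (λ { (inj₁ refl) → from (labelled x x) refl ; (inj₂ (z , refl , refl)) → from (labelled _ _) (label-swap z) })
    where
    labelled : Labelling matchingPartition label
    labelled = labelling-induced place (H partnerPermutation) (labelling-H partnerPermutation)

-- Parts crossing a threshold

filterFin : {R : Fin n → Set} → Decidable R →
  ∃₂ λ m (f : Fin m → Fin n) → StrictlyMonotone f × (∀ i → R (f i)) × (∀ x → R x → ∃ λ i → f i ≡ x)
filterFin {zero}  R? = 0 , (λ ()) , (λ { {()} }) , (λ ()) , λ ()
filterFin {suc n} {R} R? with filterFin (R? ∘ suc) | R? zero
... | m , f , mono , sound , complete | no ¬R0 =
      m , suc ∘ f , s<s ∘ mono , sound ,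
      λ { zero R0 → contradiction R0 ¬R0 ; (suc x) Rx → let i , eq = complete x Rx in i , cong suc eq }
... | m , f , mono , sound , complete | yes R0
      with g , g-mono , g0 , gs ← cons-strictlyMonotone mono =
      suc m , g , g-mono ,
      (λ { zero → subst R (sym g0) R0 ; (suc i) → subst R (sym (gs i)) (sound i) }) ,
      λ { zero R0 → zero , g0 ; (suc x) Rx → let i , eq = complete x Rx in suc i , trans (gs i) (cong suc eq) }

-- An intrinsic consequence of membership in `𝓜`, with no reference to a larger `H σ`. It yields
-- both the matching data and the bound on the size of parts.
record Crossing (P : Partition n) : Set₁ where
  field
    Left       : Fin n → Set
    left?      : Decidable Left
    left-down  : ∀ {x y} → x Fin.≤ y → Left y → Left x
    left-same  : ∀ {x y} → Same P x y → Left x → Left y → x ≡ y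
    right-same : ∀ {x y} → Same P x y → ¬ Left x → ¬ Left y → x ≡ y

  PairData : Set
  PairData = ∃ λ k → ∃₂ λ (s : Fin (k + k) → Fin n) (π : Permutation′ k) → StrictlyMonotone s × Matching P s π

  -- `α` and `β` list the left and right elements of the pairs. They are found separately, so their
  -- numbers are equal only by virtue of the bijection `π`.
  matching-from : ∀ {a b} {α : Fin a → Fin n} {β : Fin b → Fin n} → StrictlyMonotone α → StrictlyMonotone β →
    (∀ i → Left (α i)) → (∀ j → ¬ Left (β j)) →
    (∀ {x y} → Same P x y → Left x → ¬ Left y → ∃₂ λ i j → α i ≡ x × β j ≡ y) →
    (π : Permutation a b) → (∀ i → Same P (α i) (β (π ⟨$⟩ʳ i))) → PairData
  matching-from {a} {b} {α} {β} α-mono β-mono α-left β-right complete π π-same with refl ← ↔⇒≡ π =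
    a , s , π , ⊹-mono α-mono β-mono α<β , matching λ x y → mk⇔ there′ back′
    where
    s : Fin (a + a) → Fin n
    s = α ⊹ β
    α<β : ∀ i j → α i Fin.< β j
    α<β i j = ℕ.≰⇒> λ βj≤αi → β-right j (left-down βj≤αi (α-left i))
    s-swap-↑ˡ : ∀ i → s (swapPairs π (i ↑ˡ a)) ≡ β (π ⟨$⟩ʳ i)
    s-swap-↑ˡ i = trans (cong s (swapPairs-↑ˡ π i)) (⊹-↑ʳ α β (π ⟨$⟩ʳ i))
    s-swap-↑ʳ : ∀ j → s (swapPairs π (a ↑ʳ j)) ≡ α (π ⟨$⟩ˡ j)
    s-swap-↑ʳ j = trans (cong s (swapPairs-↑ʳ π j)) (⊹-↑ˡ α β (π ⟨$⟩ˡ j))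
    pair-same : ∀ z → Same P (s z) (s (swapPairs π z))
    pair-same z with side {a} {a} z
    ... | leftSide i  = ≡.subst₂ (Same P) (sym (⊹-↑ˡ α β i)) (sym (s-swap-↑ˡ i)) (π-same i)
    ... | rightSide j = ≡.subst₂ (Same P) (sym (⊹-↑ʳ α β j)) (sym (s-swap-↑ʳ j))
            (same-sym P (subst (Same P (α (π ⟨$⟩ˡ j)) ∘ β) (inverseʳ π) (π-same (π ⟨$⟩ˡ j))))
    crossing : ∀ {x y} → Same P x y → Left x → ¬ Left y → Matched s π x y
    crossing xy lx ¬ly with i , j , refl , refl ← complete xy lx ¬ly =
      inj₂ (i ↑ˡ a , sym (⊹-↑ˡ α β i) ,
            trans (right-same (same-trans P (same-sym P xy) (π-same i)) ¬ly (β-right _)) (sym (s-swap-↑ˡ i)))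
    there′ : ∀ {x y} → Same P x y → Matched s π x y
    there′ {x} {y} xy with left? x | left? y
    ... | yes lx | yes ly = inj₁ (left-same xy lx ly)
    ... | yes lx | no ¬ly = crossing xy lx ¬ly
    ... | no ¬lx | yes ly = matched-sym s π (crossing (same-sym P xy) ly ¬lx)
    ... | no ¬lx | no ¬ly = inj₁ (right-same xy ¬lx ¬ly)
    back′ : ∀ {x y} → Matched s π x y → Same P x y
    back′ (inj₁ refl)              = same-refl P _
    back′ (inj₂ (z , refl , refl)) = pair-same z

  -- The pairs are the parts that meet both sides. Since a part has at most one element on each
  -- side, the partners found from the left and from the right are mutually inverse.
  pairData : PairData
  pairData with filterFin opener? | filterFin closer?
    where
    opener? : Decidable (λ x → Left x × ∃ λ y → ¬ Left y × Same P x y)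
    opener? x = left? x ×-dec Fin.any? λ y → ¬? (left? y) ×-dec same? P x y
    closer? : Decidable (λ y → ¬ Left y × ∃ λ x → Left x × Same P x y)
    closer? y = ¬? (left? y) ×-dec Fin.any? λ x → left? x ×-dec same? P x y
  ... | a , α , α-mono , α-opens , α-all | b , β , β-mono , β-closes , β-all =
    matching-from α-mono β-mono α-left β-right
      (λ {x} {y} xy lx ¬ly → let i , αi = α-all x (lx , y , ¬ly , xy)
                                 j , βj = β-all y (¬ly , x , lx , xy)
                             in i , j , αi , βj)
      (permutation (proj₁ ∘ φ) (proj₁ ∘ ψ)
        (λ j → mono-injective β-mono (right-same (same-trans P (same-sym P (φ-same (proj₁ (ψ j)))) (ψ-same j)) (β-right _) (β-right _)))
        (λ i → mono-injective α-mono (left-same (same-trans P (ψ-same (proj₁ (φ i))) (same-sym P (φ-same i))) (α-left _) (α-left _))))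
      φ-same
    where
    α-left : ∀ i → Left (α i)
    α-left i = proj₁ (α-opens i)
    β-right : ∀ j → ¬ Left (β j)
    β-right j = proj₁ (β-closes j)
    φ : ∀ i → ∃ λ j → β j ≡ proj₁ (proj₂ (α-opens i))
    φ i = let _ , y , ¬ly , xy = α-opens i in β-all y (¬ly , α i , α-left i , xy)
    φ-same : ∀ i → Same P (α i) (β (proj₁ (φ i)))
    φ-same i = subst (Same P (α i)) (sym (proj₂ (φ i))) (proj₂ (proj₂ (proj₂ (α-opens i))))
    ψ : ∀ j → ∃ λ i → α i ≡ proj₁ (proj₂ (β-closes j))
    ψ j = let _ , x , lx , xy = β-closes j in α-all x (lx , β j , β-right j , xy)
    ψ-same : ∀ j → Same P (α (proj₁ (ψ j))) (β j)
    ψ-same j = subst (λ x → Same P x (β j)) (sym (proj₂ (ψ j))) (proj₂ (proj₂ (proj₂ (β-closes j))))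

  -- One element at most on each side of the threshold.
  part-size≤2 : All (λ A → ∣ A ∣ ≤ 2) (parts P)
  part-size≤2 = All.tabulate small
    where
    ∣p∪q∣≤ : ∀ {n} (p q : Subset n) → ∣ p ∪ q ∣ ≤ ∣ p ∣ + ∣ q ∣
    ∣p∪q∣≤ []          []          = z≤n
    ∣p∪q∣≤ (true  ∷ p) (true  ∷ q) = s≤s (ℕ.≤-trans (∣p∪q∣≤ p q) (ℕ.+-monoʳ-≤ ∣ p ∣ (ℕ.n≤1+n ∣ q ∣)))
    ∣p∪q∣≤ (true  ∷ p) (false ∷ q) = s≤s (∣p∪q∣≤ p q)
    ∣p∪q∣≤ (false ∷ p) (true  ∷ q) = ℕ.≤-trans (s≤s (∣p∪q∣≤ p q)) (ℕ.≤-reflexive (sym (ℕ.+-suc ∣ p ∣ ∣ q ∣)))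
    ∣p∪q∣≤ (false ∷ p) (false ∷ q) = ∣p∪q∣≤ p q

    ⊆two : ∀ {A : Subset n} x y → (∀ {z} → z ∈ A → z ≡ x ⊎ z ≡ y) → ∣ A ∣ ≤ 2
    ⊆two {A} x y cover = begin
      ∣ A ∣                     ≤⟨ p⊆q⇒∣p∣≤∣q∣ {p = A} {q = ⁅ x ⁆ ∪ ⁅ y ⁆}
                                  (λ z∈A → x∈p∪q⁺ ([ (λ { refl → inj₁ (x∈⁅x⁆ x) }) , (λ { refl → inj₂ (x∈⁅x⁆ y) }) ]′ (cover z∈A))) ⟩
      ∣ ⁅ x ⁆ ∪ ⁅ y ⁆ ∣         ≤⟨ ∣p∪q∣≤ ⁅ x ⁆ ⁅ y ⁆ ⟩
      ∣ ⁅ x ⁆ ∣ + ∣ ⁅ y ⁆ ∣     ≡⟨ cong₂ _+_ (∣⁅x⁆∣≡1 x) (∣⁅x⁆∣≡1 y) ⟩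
      2                         ∎
      where open ℕ.≤-Reasoning

    small : ∀ {A} → A List.∈ parts P → ∣ A ∣ ≤ 2
    small {A} A∈P with x , x∈A ← All.lookup (nonempty P) A∈P
      | Fin.any? (λ l → left? l ×-dec (l ∈? A))
      | Fin.any? (λ r → ¬? (left? r) ×-dec (r ∈? A))
    ... | yes (l , ll , l∈A) | yes (r , ¬lr , r∈A) = ⊆two l r λ {z} z∈A → cases z∈A (left? z)
      where
      cases : ∀ {z} → z ∈ A → Dec (Left z) → z ≡ l ⊎ z ≡ r
      cases z∈A (yes lz) = inj₁ (left-same (lose A∈P (z∈A , l∈A)) lz ll)
      cases z∈A (no ¬lz) = inj₂ (right-same (lose A∈P (z∈A , r∈A)) ¬lz ¬lr)
    ... | no noLeft | _ = ⊆two x x λ {z} z∈A → inj₁ (right-same (lose A∈P (z∈A , x∈A))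
        (λ lz → noLeft (z , lz , z∈A)) (λ lx → noLeft (x , lx , x∈A)))
    ... | yes _ | no noRight = ⊆two x x λ {z} z∈A → inj₁ (left-same (lose A∈P (z∈A , x∈A))
        (isLeft z∈A (left? z)) (isLeft x∈A (left? x)))
      where
      isLeft : ∀ {z} → z ∈ A → Dec (Left z) → Left z
      isLeft z∈A (yes lz) = lz
      isLeft z∈A (no ¬lz) = contradiction (_ , ¬lz , z∈A) noRight

-- The hereditary closure of the partitions H π.
𝓜 : Property
𝓜 = record
  { Contains = λ {n} P → ∃ λ m → ∃₂ λ (σ : Permutation′ m) (s : Fin n → Fin (m + m)) → StrictlyMonotone s × induced s (H σ) ≈ P
  ; resp     = λ {n} {P} {Q} P≈Q (m , σ , s , s-mono , eq) → m , σ , s , s-mono , ≈-trans (induced s (H σ)) P Q eq P≈Q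
  }

induced-cong : (s : Fin k → Fin n) (P Q : Partition n) → P ≈ Q → induced s P ≈ induced s Q
induced-cong s P Q P≈Q = same⇒≈ (induced s P) (induced s Q) λ x y → mk⇔
  (from (same-induced s Q x y) ∘ ≈⇒same P Q P≈Q ∘ to (same-induced s P x y))
  (from (same-induced s P x y) ∘ ≈⇒same Q P (≈-sym P Q P≈Q) ∘ to (same-induced s Q x y))

induced-∘ : (t : Fin k → Fin l) (s : Fin l → Fin n) (P : Partition n) → induced (s ∘ t) P ≈ induced t (induced s P)
induced-∘ t s P = same⇒≈ (induced (s ∘ t) P) (induced t (induced s P)) λ x y →
  ⇔-sym (same-induced t (induced s P) x y) ⇔-∘ (⇔-sym (same-induced s P (t x) (t y)) ⇔-∘ same-induced (s ∘ t) P x y)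

𝓜-hereditary : Hereditary 𝓜
𝓜-hereditary P t t-mono (m , σ , s , s-mono , eq) = m , σ , s ∘ t , s-mono ∘ t-mono ,
  ≈-trans (induced (s ∘ t) (H σ)) (induced t (induced s (H σ))) (induced t P)
    (induced-∘ t s (H σ)) (induced-cong t (induced s (H σ)) P eq)

𝓜⊆ : ∀ 𝒫 → Hereditary 𝒫 → (∀ k (π : Permutation′ k) → 𝒫 ∋ H π) → (P : Partition n) → 𝓜 ∋ P → 𝒫 ∋ P
𝓜⊆ 𝒫 hereditary contains P (m , σ , s , s-mono , eq) =
  Property.resp 𝒫 {P = induced s (H σ)} {Q = P} eq (hereditary (H σ) s s-mono (contains m σ))

-- The threshold is the middle of `[2m]` pulled back along `s`: each part of `H σ` has one element
-- in each half.
𝓜⇒crossing : (P : Partition n) → 𝓜 ∋ P → Crossing P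
𝓜⇒crossing {n} P (m , σ , s , s-mono , eq) = record
  { Left       = λ x → toℕ (s x) < m
  ; left?      = λ x → toℕ (s x) ℕ.<? m
  ; left-down  = λ x≤y ly → ℕ.≤-<-trans (strictlyMonotone⇒monotone s-mono x≤y) ly
  ; left-same  = λ xy lx ly → mono-injective s-mono (left-index (s _) (s _) (index xy) lx ly)
  ; right-same = λ xy ¬lx ¬ly → mono-injective s-mono (right-index (s _) (s _) (index xy) ¬lx ¬ly)
  }
  where
  index : ∀ {x y} → Same P x y → pairIndex σ (s x) ≡ pairIndex σ (s y)
  index {x} {y} xy = to (labelling-induced s (H σ) (labelling-H σ) x y)
    (≈⇒same P (induced s (H σ)) (≈-sym (induced s (H σ)) P eq) xy)
  ¬right : ∀ j → ¬ toℕ (m ↑ʳ j) < m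
  ¬right j lt = ℕ.<⇒≱ lt (ℕ.≤-trans (ℕ.m≤m+n m (toℕ j)) (ℕ.≤-reflexive (sym (Fin.toℕ-↑ʳ m j))))
  left! : ∀ (i : Fin m) → toℕ (i ↑ˡ m) < m
  left! i = subst (_< m) (sym (Fin.toℕ-↑ˡ i m)) (Fin.toℕ<n i)
  left-index : ∀ z z′ → pairIndex σ z ≡ pairIndex σ z′ → toℕ z < m → toℕ z′ < m → z ≡ z′
  left-index z z′ eq lz lz′ with side {m} {m} z | side {m} {m} z′
  ... | leftSide i  | leftSide i′ = cong (_↑ˡ m) (trans (sym (pairIndex-↑ˡ σ i)) (trans eq (pairIndex-↑ˡ σ i′)))
  ... | rightSide j | _           = contradiction lz (¬right j)
  ... | leftSide _  | rightSide j = contradiction lz′ (¬right j)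
  right-index : ∀ z z′ → pairIndex σ z ≡ pairIndex σ z′ → ¬ toℕ z < m → ¬ toℕ z′ < m → z ≡ z′
  right-index z z′ eq ¬lz ¬lz′ with side {m} {m} z | side {m} {m} z′
  ... | rightSide j | rightSide j′ = cong (m ↑ʳ_) (trans (sym (inverseʳ σ)) (trans (cong (σ ⟨$⟩ʳ_)
          (trans (sym (pairIndex-↑ʳ σ j)) (trans eq (pairIndex-↑ʳ σ j′)))) (inverseʳ σ)))
  ... | leftSide i  | _          = contradiction (left! i) ¬lz
  ... | rightSide _ | leftSide i = contradiction (left! i) ¬lz′

-- The bijection between codes and the partitions in `𝓜`

codePartition : Code n → Partition n
codePartition (k , S , c) = matchingPartition (enumerate-mono S) (decode c)

codePartition-matching : ((k , S , c) : Code n) → Matching (codePartition (k , S , c)) (enumerate S) (decode c)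
codePartition-matching (k , S , c) = matchingPartition-matching (enumerate-mono S) (decode c)

codePartition∈𝓜 : (c : Code n) → 𝓜 ∋ codePartition c
codePartition∈𝓜 {n} (k , S , c) = n , partnerPermutation (enumerate-mono S) (decode c) ,
  place (enumerate-mono S) (decode c) , place-mono (enumerate-mono S) (decode c) , mk⇔ id id

matching-code-unique : (P : Partition n)
  (S : Choice n (k + k)) (T : Choice n (l + l)) (c : PermutationCode k) (d : PermutationCode l) →
  Matching P (enumerate S) (decode c) → Matching P (enumerate T) (decode d) → _≡_ {A = Code n} (k , S , c) (l , T , d)
matching-code-unique P S T c d mS mT
  with refl ← matching-size P (enumerate-mono S) (enumerate-mono T) mS mT
  with s≗ , π≈ ← matching-data-unique P (enumerate-mono S) (enumerate-mono T) mS mT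
  with refl ← enumerate-injective S T s≗ | refl ← decode-injective c d π≈ = refl

codePartition-injective : (c d : Code n) → codePartition c ≈ codePartition d → c ≡ d
codePartition-injective x@(k , S , c) y@(l , T , d) eq = matching-code-unique (codePartition y) S T c d
  (matching-≈ (codePartition x) (codePartition y) eq (codePartition-matching x)) (codePartition-matching y)

codePartition-matched : (P : Partition n) {s : Fin (k + k) → Fin n} {π : Permutation′ k} → Matching P s π →
  (∃ λ S → enumerate S ≗ s) → (∃ λ c → decode c Perm.≈ π) → ∃ λ c → codePartition c ≈ P
codePartition-matched P mP (S , S≗) (c , c≈) = (_ , S , c) ,
  matching-unique (codePartition (_ , S , c)) P (codePartition-matching (_ , S , c)) (matching-resp P (sym ∘ S≗) (sym ∘ c≈) mP)

crossing⇒code : (P : Partition n) → Crossing P → ∃ λ c → codePartition c ≈ P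
crossing⇒code P crossing = uncoded (Crossing.pairData crossing)
  where
  uncoded : Crossing.PairData crossing → ∃ λ c → codePartition c ≈ P
  uncoded (k , s , π , s-mono , mP) = codePartition-matched P mP (enumerate-surjective s s-mono) (decode-surjective π)

codePartition-surjective : (P : Partition n) → 𝓜 ∋ P → ∃ λ c → codePartition c ≈ P
codePartition-surjective P P∈𝓜 = crossing⇒code P (𝓜⇒crossing P P∈𝓜)

𝓜-size : ∀ n → ∣ 𝓜 at n ∣≡ bound n
𝓜-size n = record
  { to        = λ x → codePartition (code n x) , codePartition∈𝓜 (code n x)
  ; cong      = λ { {x} refl → mk⇔ id id }
  ; bijective = (λ {x} {y} eq → code-injective n (codePartition-injective (code n x) (code n y) eq)) ,
      λ (P , P∈𝓜) →
        let c , c≈P = codePartition-surjective P P∈𝓜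
            x , x↦c = code-surjective n c
        in x , λ { refl → subst (λ c → codePartition c ≈ P) (sym x↦c) c≈P }
  }

-- Growth of the bound

open ℕ.≤-Reasoning

^-distribʳ-* : ∀ a b n → (a * b) ^ n ≡ a ^ n * b ^ n
^-distribʳ-* a b zero    = refl
^-distribʳ-* a b (suc n) = trans (cong (a * b *_) (^-distribʳ-* a b n)) (arith a b (a ^ n) (b ^ n))
  where
  arith : ∀ a b x y → a * b * (x * y) ≡ a * x * (b * y)
  arith = solve-∀

^-swap : ∀ a m n → (a ^ m) ^ n ≡ (a ^ n) ^ m
^-swap a m n = trans (ℕ.^-*-assoc a m n) (trans (cong (a ^_) (ℕ.*-comm m n)) (sym (ℕ.^-*-assoc a n m)))

suc≤2^ : ∀ n → suc n ≤ 2 ^ n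
suc≤2^ zero    = ℕ.≤-refl
suc≤2^ (suc n) = begin
  suc (suc n)        ≤⟨ s≤s (ℕ.m≤n+m (suc n) n) ⟩
  suc n + suc n      ≤⟨ ℕ.+-mono-≤ (suc≤2^ n) (suc≤2^ n) ⟩
  2 ^ n + 2 ^ n      ≡⟨ cong (2 ^ n +_) (ℕ.+-identityʳ (2 ^ n)) ⟨
  2 ^ suc n          ∎

C≤2^ : ∀ n k → n C k ≤ 2 ^ n
C≤2^ n       zero    = ℕ.≤-trans (ℕ.≤-reflexive (nC0≡1 n)) (ℕ.m^n>0 2 n)
C≤2^ zero    (suc k) = z≤n
C≤2^ (suc n) (suc k) = begin
  suc n C suc k          ≡⟨ nCk+nC[k+1]≡[n+1]C[k+1] n k ⟨
  n C k + n C (suc k)    ≤⟨ ℕ.+-mono-≤ (C≤2^ n k) (C≤2^ n (suc k)) ⟩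
  2 ^ n + 2 ^ n          ≡⟨ cong (2 ^ n +_) (ℕ.+-identityʳ (2 ^ n)) ⟨
  2 ^ suc n              ∎

1≤C : ∀ n k → k ≤ n → 1 ≤ n C k
1≤C n       zero    _   = ℕ.≤-reflexive (sym (nC0≡1 n))
1≤C (suc n) (suc k) k≤n = begin
  1                      ≤⟨ 1≤C n k (s≤s⁻¹ k≤n) ⟩
  n C k                  ≤⟨ ℕ.m≤m+n (n C k) (n C suc k) ⟩
  n C k + n C (suc k)    ≡⟨ nCk+nC[k+1]≡[n+1]C[k+1] n k ⟩
  suc n C suc k          ∎

!-mono-≤ : ∀ {m n} → m ≤ n → m ! ≤ n !
!-mono-≤ {zero}  {n}     _   = ℕ.1≤n! n
!-mono-≤ {suc m} {suc n} m≤n = ℕ.*-mono-≤ m≤n (!-mono-≤ (s≤s⁻¹ m≤n))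

!≤^ : ∀ n → n ! ≤ n ^ n
!≤^ zero    = ℕ.≤-refl
!≤^ (suc n) = ℕ.*-monoʳ-≤ (suc n) (ℕ.≤-trans (!≤^ n) (ℕ.^-monoˡ-≤ n (ℕ.n≤1+n n)))

!*^≤! : ∀ k j → k ! * k ^ j ≤ (k + j) !
!*^≤! k zero    = ℕ.≤-reflexive (trans (ℕ.*-identityʳ (k !)) (cong _! (sym (ℕ.+-identityʳ k))))
!*^≤! k (suc j) = begin
  k ! * (k * k ^ j)          ≡⟨ arith (k !) k (k ^ j) ⟩
  k * (k ! * k ^ j)          ≤⟨ ℕ.*-mono-≤ (ℕ.≤-trans (ℕ.m≤m+n k j) (ℕ.n≤1+n (k + j))) (!*^≤! k j) ⟩
  suc (k + j) * (k + j) !    ≡⟨ cong _! (ℕ.+-suc k j) ⟨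
  (k + suc j) !              ∎
  where
  arith : ∀ x y z → x * (y * z) ≡ y * (x * z)
  arith = solve-∀

C*!*! : ∀ k → ((k + k) C k) * (k ! * k !) ≡ (k + k) !
C*!*! k = trans
  (cong₂ _*_ (nCk≡n!/k![n-k]! (ℕ.m≤m+n k k)) (cong (k ! *_) (cong _! (sym (ℕ.m+n∸n≡m k k)))))
  (m/n*n≡m {{k ℕ.!* (k + k ∸ k) !≢0}} (k![n∸k]!∣n! (ℕ.m≤m+n k k)))

-- Cancel `k !` in `k ! * k ^ k ≤ (k + k) !`, where the right side is a binomial coefficient, at
-- most `4 ^ k`, times `k ! * k !`. This serves as a weak form of Stirling's formula.
^≤4^*! : ∀ k → k ^ k ≤ 4 ^ k * k !
^≤4^*! k = ℕ.*-cancelˡ-≤ (k !) {{k ℕ.!≢0}} (begin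
  k ! * k ^ k                      ≤⟨ !*^≤! k k ⟩
  (k + k) !                        ≡⟨ C*!*! k ⟨
  ((k + k) C k) * (k ! * k !)      ≤⟨ ℕ.*-monoˡ-≤ (k ! * k !) (C≤2^ (k + k) k) ⟩
  2 ^ (k + k) * (k ! * k !)        ≡⟨ cong (_* (k ! * k !)) (trans (cong (λ k′ → 2 ^ (k + k′)) (sym (ℕ.+-identityʳ k)))
                                       (sym (ℕ.^-*-assoc 2 2 k))) ⟩
  4 ^ k * (k ! * k !)              ≡⟨ arith (4 ^ k) (k !) ⟩
  k ! * (4 ^ k * k !)              ∎)
  where
  arith : ∀ x y → x * (y * y) ≡ y * (x * y)
  arith = solve-∀

sum-applyUpTo-≤ : ∀ (f : ℕ → ℕ) K {c} → (∀ {k} → k < K → f k ≤ c) → listSum (applyUpTo f K) ≤ K * c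
sum-applyUpTo-≤ f zero    f≤c = z≤n
sum-applyUpTo-≤ f (suc K) f≤c = ℕ.+-mono-≤ (f≤c (s≤s z≤n)) (sum-applyUpTo-≤ (f ∘ suc) K (f≤c ∘ s<s))

term≤sum-applyUpTo : ∀ (f : ℕ → ℕ) K {k} → k < K → f k ≤ listSum (applyUpTo f K)
term≤sum-applyUpTo f (suc K) {zero}  _   = ℕ.m≤m+n (f 0) _
term≤sum-applyUpTo f (suc K) {suc k} k<K = ℕ.m≤n⇒m≤o+n (f 0) (term≤sum-applyUpTo (f ∘ suc) K (s<s⁻¹ k<K))

module _ (n : ℕ) where

  private
    h = ⌊ n /2⌋

    term : ℕ → ℕ
    term = boundTerm n

    2h≤n : 2 * h ≤ n
    2h≤n = begin
      h + (h + 0)           ≡⟨ cong (h +_) (ℕ.+-identityʳ h) ⟩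
      h + h                 ≤⟨ ℕ.+-monoʳ-≤ h (ℕ.⌊n/2⌋≤⌈n/2⌉ n) ⟩
      h + ⌈ n /2⌉ ≡⟨ ℕ.⌊n/2⌋+⌈n/2⌉≡n n ⟩
      n                     ∎

    n≤1+2h : n ≤ suc (h + h)
    n≤1+2h = begin
      n                         ≡⟨ ℕ.⌊n/2⌋+⌈n/2⌉≡n n ⟨
      h + ⌈ n /2⌉ ≤⟨ ℕ.+-monoʳ-≤ h (ℕ.⌊n/2⌋-mono (ℕ.n≤1+n (suc n))) ⟩
      h + suc h                 ≡⟨ ℕ.+-suc h h ⟩
      suc (h + h)               ∎

  ⌊n/2⌋!≤bound : h ! ≤ bound n
  ⌊n/2⌋!≤bound = begin
    h !                              ≡⟨ ℕ.*-identityˡ (h !) ⟨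
    1 * h !                          ≤⟨ ℕ.*-monoˡ-≤ (h !) (1≤C n (2 * h) 2h≤n) ⟩
    (n C (2 * h)) * h !              ≤⟨ term≤sum-applyUpTo term (suc h) ℕ.≤-refl ⟩
    listSum (applyUpTo term (suc h))     ≡⟨ (bound-applyUpTo n) ⟨
    bound n                          ∎

  -- One factor `2 ^ n` bounds the binomial coefficients and another the number of summands.
  bound≤4^*^ : bound n ≤ 4 ^ n * n ^ h
  bound≤4^*^ = begin
    bound n                          ≡⟨ (bound-applyUpTo n) ⟩
    listSum (applyUpTo term (suc h))     ≤⟨ sum-applyUpTo-≤ term (suc h) (λ {k} k≤h → ℕ.*-mono-≤ (C≤2^ n (2 * k)) (!≤ (s≤s⁻¹ k≤h))) ⟩
    suc h * (2 ^ n * n ^ h)          ≤⟨ ℕ.*-monoˡ-≤ (2 ^ n * n ^ h) (ℕ.≤-trans (s≤s (ℕ.⌊n/2⌋≤n n)) (suc≤2^ n)) ⟩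
    2 ^ n * (2 ^ n * n ^ h)          ≡⟨ ℕ.*-assoc (2 ^ n) (2 ^ n) (n ^ h) ⟨
    2 ^ n * 2 ^ n * n ^ h            ≡⟨ cong (_* n ^ h) (^-distribʳ-* 2 2 n) ⟨
    4 ^ n * n ^ h                    ∎
    where
    !≤ : ∀ {k} → k ≤ h → k ! ≤ n ^ h
    !≤ {k} k≤h = ℕ.≤-trans (!-mono-≤ k≤h) (ℕ.≤-trans (!≤^ h) (ℕ.^-monoˡ-≤ h (ℕ.⌊n/2⌋≤n n)))

  bound²≤ : .{{_ : NonZero n}} → bound n ^ 2 ≤ 16 ^ n * n ^ n
  bound²≤ = begin
    bound n ^ 2                      ≤⟨ ℕ.^-monoˡ-≤ 2 bound≤4^*^ ⟩
    (4 ^ n * n ^ h) ^ 2              ≡⟨ ^-distribʳ-* (4 ^ n) (n ^ h) 2 ⟩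
    (4 ^ n) ^ 2 * (n ^ h) ^ 2        ≡⟨ cong₂ _*_ (^-swap 4 n 2) (trans (ℕ.^-*-assoc n h 2) (cong (n ^_) (ℕ.*-comm h 2))) ⟩
    16 ^ n * n ^ (2 * h)             ≤⟨ ℕ.*-monoʳ-≤ (16 ^ n) (ℕ.^-monoʳ-≤ n 2h≤n) ⟩
    16 ^ n * n ^ n                   ∎

  -- `144` is the square of `12 = 3 * 4`, with `3` from `n ≤ 3 * h` and `4` from `^≤4^*!`. The
  -- factor `n` accounts for odd `n`.
  n^n≤ : 2 ≤ n → n ^ n ≤ n * 144 ^ n * bound n ^ 2
  n^n≤ 2≤n = begin
    n ^ n                                    ≤⟨ ℕ.^-monoʳ-≤ n n≤1+2h ⟩
    n * n ^ (h + h)                          ≤⟨ ℕ.*-monoʳ-≤ n (ℕ.^-monoˡ-≤ (h + h) n≤3h) ⟩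
    n * (3 * h) ^ (h + h)                    ≡⟨ cong (n *_) (ℕ.^-distribˡ-+-* (3 * h) h h) ⟩
    n * ((3 * h) ^ h * (3 * h) ^ h)          ≡⟨ cong (λ x → n * (x * x)) (^-distribʳ-* 3 h h) ⟩
    n * (3 ^ h * h ^ h * (3 ^ h * h ^ h))    ≤⟨ ℕ.*-monoʳ-≤ n (ℕ.*-mono-≤ step step) ⟩
    n * (12 ^ h * h ! * (12 ^ h * h !))      ≡⟨ arith n (12 ^ h) (h !) ⟩
    n * (12 ^ h * 12 ^ h) * (h !) ^ 2          ≡⟨ cong (λ x → n * x * (h !) ^ 2) (^-distribʳ-* 12 12 h) ⟨
    n * 144 ^ h * (h !) ^ 2                    ≤⟨ ℕ.*-mono-≤ (ℕ.*-monoʳ-≤ n (ℕ.^-monoʳ-≤ 144 (ℕ.⌊n/2⌋≤n n))) (ℕ.^-monoˡ-≤ 2 ⌊n/2⌋!≤bound) ⟩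
    n * 144 ^ n * bound n ^ 2                ∎
    where
    instance
      n≢0 : NonZero n
      n≢0 = >-nonZero (ℕ.≤-trans (s≤s z≤n) 2≤n)
    n≤3h : n ≤ 3 * h
    n≤3h = begin
      n              ≤⟨ n≤1+2h ⟩
      1 + (h + h)    ≤⟨ ℕ.+-monoˡ-≤ (h + h) (ℕ.⌊n/2⌋-mono 2≤n) ⟩
      h + (h + h)    ≡⟨ cong (λ x → h + (h + x)) (ℕ.+-identityʳ h) ⟨
      3 * h          ∎
    step : 3 ^ h * h ^ h ≤ 12 ^ h * h !
    step = begin
      3 ^ h * h ^ h            ≤⟨ ℕ.*-monoʳ-≤ (3 ^ h) (^≤4^*! h) ⟩
      3 ^ h * (4 ^ h * h !)    ≡⟨ ℕ.*-assoc (3 ^ h) (4 ^ h) (h !) ⟨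
      3 ^ h * 4 ^ h * h !      ≡⟨ cong (_* h !) (^-distribʳ-* 3 4 h) ⟨
      12 ^ h * h !             ∎
    arith : ∀ n x y → n * (x * y * (x * y)) ≡ n * (x * x) * (y * (y * 1))
    arith = solve-∀

bound-isHalfPower : IsHalfPower bound
-- From `2` on, `n^n≤` applies; `q` gives `n ^ q ≤ n ^ n`, and `144 ^ q` lets another `n ^ n` absorb
-- the exponential factors. The total error `n ^ (2 * n)` is allowed since `p` is at least one.
bound-isHalfPower p q = 2 + q + 144 ^ q , λ n n₀≤n → lower n n₀≤n , upper n n₀≤n
  where
  module _ (n : ℕ) (n₀≤n : 2 + q + 144 ^ q ≤ n) where
    2≤n : 2 ≤ n
    2≤n = ℕ.≤-trans (ℕ.≤-trans (ℕ.m≤m+n 2 q) (ℕ.m≤m+n (2 + q) (144 ^ q))) n₀≤n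
    q≤n : q ≤ n
    q≤n = ℕ.≤-trans (ℕ.≤-trans (ℕ.m≤n+m q 2) (ℕ.m≤m+n (2 + q) (144 ^ q))) n₀≤n
    144^q≤n : 144 ^ q ≤ n
    144^q≤n = ℕ.≤-trans (ℕ.m≤n+m (144 ^ q) (2 + q)) n₀≤n
    instance
      n≢0 : NonZero n
      n≢0 = >-nonZero (ℕ.≤-trans (s≤s z≤n) 2≤n)

    2n≤2pn : 2 * n ≤ 2 * p * n
    2n≤2pn = ℕ.*-monoˡ-≤ n (ℕ.m≤m*n 2 p)

    n^n^q : (n ^ n) ^ q ≡ n ^ (q * n)
    n^n^q = trans (ℕ.^-*-assoc n n q) (cong (n ^_) (ℕ.*-comm n q))

    lower : n ^ (q * n) ≤ bound n ^ (2 * q) * n ^ (2 * p * n)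
    lower = begin
      n ^ (q * n)                                  ≡⟨ n^n^q ⟨
      (n ^ n) ^ q                                  ≤⟨ ℕ.^-monoˡ-≤ q (n^n≤ n 2≤n) ⟩
      (n * 144 ^ n * bound n ^ 2) ^ q              ≡⟨ ^-distribʳ-* (n * 144 ^ n) (bound n ^ 2) q ⟩
      (n * 144 ^ n) ^ q * (bound n ^ 2) ^ q        ≡⟨ cong₂ _*_ (^-distribʳ-* n (144 ^ n) q) (ℕ.^-*-assoc (bound n) 2 q) ⟩
      n ^ q * (144 ^ n) ^ q * bound n ^ (2 * q)    ≡⟨ cong (λ x → n ^ q * x * bound n ^ (2 * q)) (^-swap 144 n q) ⟩
      n ^ q * (144 ^ q) ^ n * bound n ^ (2 * q)    ≤⟨ ℕ.*-monoˡ-≤ (bound n ^ (2 * q)) (ℕ.*-mono-≤ (ℕ.^-monoʳ-≤ n q≤n) (ℕ.^-monoˡ-≤ n 144^q≤n)) ⟩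
      n ^ n * n ^ n * bound n ^ (2 * q)            ≡⟨ cong (_* bound n ^ (2 * q)) (ℕ.^-distribˡ-+-* n n n) ⟨
      n ^ (n + n) * bound n ^ (2 * q)              ≡⟨ cong (λ x → n ^ (n + x) * bound n ^ (2 * q)) (ℕ.+-identityʳ n) ⟨
      n ^ (2 * n) * bound n ^ (2 * q)              ≤⟨ ℕ.*-monoˡ-≤ (bound n ^ (2 * q)) (ℕ.^-monoʳ-≤ n 2n≤2pn) ⟩
      n ^ (2 * p * n) * bound n ^ (2 * q)          ≡⟨ ℕ.*-comm (n ^ (2 * p * n)) (bound n ^ (2 * q)) ⟩
      bound n ^ (2 * q) * n ^ (2 * p * n)          ∎

    upper : bound n ^ (2 * q) ≤ n ^ (q * n + 2 * p * n)
    upper = begin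
      bound n ^ (2 * q)                ≡⟨ ℕ.^-*-assoc (bound n) 2 q ⟨
      (bound n ^ 2) ^ q                ≤⟨ ℕ.^-monoˡ-≤ q (bound²≤ n) ⟩
      (16 ^ n * n ^ n) ^ q             ≡⟨ ^-distribʳ-* (16 ^ n) (n ^ n) q ⟩
      (16 ^ n) ^ q * (n ^ n) ^ q       ≡⟨ cong₂ _*_ (^-swap 16 n q) n^n^q ⟩
      (16 ^ q) ^ n * n ^ (q * n)       ≤⟨ ℕ.*-monoˡ-≤ (n ^ (q * n)) (ℕ.^-monoˡ-≤ n (ℕ.≤-trans (ℕ.^-monoˡ-≤ q (ℕ.m≤m+n 16 128)) 144^q≤n)) ⟩
      n ^ n * n ^ (q * n)              ≤⟨ ℕ.*-monoˡ-≤ (n ^ (q * n)) (ℕ.^-monoʳ-≤ n (ℕ.≤-trans (ℕ.m≤n*m n 2) 2n≤2pn)) ⟩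
      n ^ (2 * p * n) * n ^ (q * n)    ≡⟨ ℕ.^-distribˡ-+-* n (2 * p * n) (q * n) ⟨
      n ^ (2 * p * n + q * n)          ≡⟨ cong (n ^_) (ℕ.+-comm (2 * p * n) (q * n)) ⟩
      n ^ (q * n + 2 * p * n)          ∎

-- With error exponent 1/4, `f N` is at least `N` to the power `N / 4`, which exceeds `a ^ N` once
-- `N` is above `a ^ 4`.
halfPower-superexponential : ∀ {f} → IsHalfPower f → ∀ a → ∃ λ n → a ^ n < f n
halfPower-superexponential {f} half a with n₀ , bounds ← half 1 4 =
  N , ℕ.≰⇒> λ fn≤ → ℕ.<⇒≱ (small fn≤) (proj₁ (bounds N (ℕ.m≤m+n n₀ _)))
  where
  N = n₀ + suc (a ^ 4)
  instance
    N≢0 : NonZero N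
    N≢0 = >-nonZero (ℕ.≤-trans (s≤s z≤n) (ℕ.m≤n+m (suc (a ^ 4)) n₀))
    2N≢0 : NonZero (2 * N)
    2N≢0 = ℕ.m*n≢0 2 N
    N^2N≢0 : NonZero (N ^ (2 * N))
    N^2N≢0 = ℕ.m^n≢0 N (2 * N)
  small : f N ≤ a ^ N → f N ^ 8 * N ^ (2 * N) < N ^ (4 * N)
  small fn≤ = begin-strict
    f N ^ 8 * N ^ (2 * N)            ≤⟨ ℕ.*-monoˡ-≤ (N ^ (2 * N)) (ℕ.^-monoˡ-≤ 8 fn≤) ⟩
    (a ^ N) ^ 8 * N ^ (2 * N)        ≡⟨ cong (_* N ^ (2 * N)) (trans (ℕ.^-*-assoc a N 8)
                                         (trans (cong (a ^_) (arith N)) (sym (ℕ.^-*-assoc a 4 (2 * N))))) ⟩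
    (a ^ 4) ^ (2 * N) * N ^ (2 * N)  <⟨ ℕ.*-monoˡ-< (N ^ (2 * N)) (ℕ.^-monoˡ-< (2 * N) (ℕ.m≤n+m (suc (a ^ 4)) n₀)) ⟩
    N ^ (2 * N) * N ^ (2 * N)        ≡⟨ ℕ.^-distribˡ-+-* N (2 * N) (2 * N) ⟨
    N ^ (2 * N + 2 * N)              ≡⟨ cong (N ^_) (ℕ.*-distribʳ-+ N 2 2) ⟨
    N ^ (4 * N)                      ∎
    where
    arith : ∀ x → x * 8 ≡ 4 * (2 * x)
    arith = solve-∀

-- The extremal property and its uniqueness

-- A missed value, added as the image of a new point, would inject a set of `n + 1` elements into
-- one of `n`.
injective⇒surjective : ∀ {n} {f : Fin n → Fin n} → Injective _≡_ _≡_ f → ∀ i → ∃ λ x → f x ≡ i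
injective⇒surjective {n} {f} f-injective i with Fin.any? (λ x → f x Fin.≟ i)
... | yes found = found
... | no missed = contradiction (Fin.injective⇒≤ g-injective) ℕ.1+n≰n
  where
  g : Fin (ℕ.suc n) → Fin n
  g zero    = i
  g (suc x) = f x
  g-injective : Injective _≡_ _≡_ g
  g-injective {zero}  {zero}  _  = refl
  g-injective {zero}  {suc y} eq = contradiction (y , sym eq) missed
  g-injective {suc x} {zero}  eq = contradiction (x , eq) missed
  g-injective {suc x} {suc y} eq = cong suc (f-injective eq)

boundSpeed⇒superExponential : ∀ 𝒬 → (∀ n → ∣ 𝒬 at n ∣≡ bound n) → SuperExponential 𝒬
boundSpeed⇒superExponential 𝒬 size = superExponential⁺ 𝒬 λ a →
  let n , lt = halfPower-superexponential bound-isHalfPower a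
  in n , bound n , Bijection.injection (size n) , lt

module _ (𝒫 : Property) (hereditary : Hereditary 𝒫) (contains : ∀ k (π : Permutation′ k) → 𝒫 ∋ H π) where

  speed≥smallParts : ∀ n → ∣ 𝒫 at n ∣≥∣ 𝒫 ⁽¹²⁾ at n ∣
  speed≥smallParts n = record { to = λ (P , P∈𝒫 , _) → P , P∈𝒫 ; cong = id ; injective = id }

  𝓜⊆smallParts : ∀ {n} (P : Partition n) → 𝓜 ∋ P → 𝒫 ⁽¹²⁾ ∋ P
  𝓜⊆smallParts P P∈𝓜 = 𝓜⊆ 𝒫 hereditary contains P P∈𝓜 , Crossing.part-size≤2 (𝓜⇒crossing P P∈𝓜)

  smallParts≥bound : ∀ n → ∣ 𝒫 ⁽¹²⁾ at n ∣≥ bound n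
  smallParts≥bound n = record
    { to        = λ x → let P , P∈𝓜 = Bijection.to (𝓜-size n) x in P , 𝓜⊆smallParts P P∈𝓜
    ; cong      = Bijection.cong (𝓜-size n)
    ; injective = Bijection.injective (𝓜-size n)
    }

  -- The inclusion of `𝓜` in `𝒫` becomes an injection of `Fin (bound n)` into itself, hence a
  -- surjection, so every partition in `𝒫` is hit by one in `𝓜`.
  boundSpeed⇒⊆𝓜 : ∀ {n} → ∣ 𝒫 at n ∣≡ bound n → (P : Partition n) → 𝒫 ∋ P → 𝓜 ∋ P
  boundSpeed⇒⊆𝓜 {n} size P P∈𝒫 =
    let x , x↦P = hits (P , P∈𝒫)
        y , fy≡x = injective⇒surjective f-injective x
        M , M∈𝓜 = 𝓜.to y
    in Property.resp 𝓜 {P = M} {Q = P}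
         (≈-trans M (proj₁ (𝒫ₙ.to x)) P
           (subst (λ x → M ≈ proj₁ (𝒫ₙ.to x)) fy≡x (≈-sym (proj₁ (𝒫ₙ.to (f y))) M (f-spec y))) x↦P)
         M∈𝓜
    where
    module 𝒫ₙ = Bijection size
    module 𝓜 = Bijection (𝓜-size n)
    hits : ∀ Q → ∃ λ x → proj₁ (𝒫ₙ.to x) ≈ proj₁ Q
    hits Q = let x , hit = 𝒫ₙ.surjective Q in x , hit refl
    index : ∀ y → ∃ λ x → proj₁ (𝒫ₙ.to x) ≈ proj₁ (𝓜.to y)
    index y = let M , M∈𝓜 = 𝓜.to y in hits (M , 𝓜⊆ 𝒫 hereditary contains M M∈𝓜)
    f : Fin (bound n) → Fin (bound n)
    f y = proj₁ (index y)
    f-spec : ∀ y → proj₁ (𝒫ₙ.to (f y)) ≈ proj₁ (𝓜.to y)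
    f-spec y = proj₂ (index y)
    f-injective : Injective _≡_ _≡_ f
    f-injective {y} {z} eq = 𝓜.injective (≈-trans M L N (≈-sym L M (f-spec y))
      (subst (λ x → proj₁ (𝒫ₙ.to x) ≈ N) (sym eq) (f-spec z)))
      where
      M = proj₁ (𝓜.to y)
      N = proj₁ (𝓜.to z)
      L = proj₁ (𝒫ₙ.to (f y))

theorem3 : (∀ (𝒫 : Property) → Hereditary 𝒫 → SuperExponential 𝒫 →
    (∀ k (π : Permutation′ k) → 𝒫 ∋ H π) ×
    (∀ n → (∣ 𝒫 at n ∣≥∣ 𝒫 ⁽¹²⁾ at n ∣) × (∣ 𝒫 ⁽¹²⁾ at n ∣≥ bound n))) ×
    IsHalfPower bound ×
    (∃ λ 𝒬 → Hereditary 𝒬 × SuperExponential 𝒬 × (∀ n → ∣ 𝒬 at n ∣≡ bound n)) ×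
    (∃! _≐_ λ 𝒬 → Hereditary 𝒬 × (∀ n → ∣ 𝒬 at n ∣≡ bound n))
theorem3 =
  (λ 𝒫 hereditary superexp →
    let contains = contains-H 𝒫 hereditary superexp
    in contains , λ n → speed≥smallParts 𝒫 hereditary contains n , smallParts≥bound 𝒫 hereditary contains n) ,
  bound-isHalfPower ,
  (𝓜 , 𝓜-hereditary , boundSpeed⇒superExponential 𝓜 𝓜-size , 𝓜-size) ,
  -- The speed alone makes a competitor `𝒬` superexponential, so the first claim applies to it and
  -- gives all the `H π`.
  (𝓜 , (𝓜-hereditary , 𝓜-size) , λ {𝒬} (hereditary , size) P →
    let contains = contains-H 𝒬 hereditary (boundSpeed⇒superExponential 𝒬 size)
    in mk⇔ (𝓜⊆ 𝒬 hereditary contains P) (boundSpeed⇒⊆𝓜 𝒬 hereditary contains (size _) P))
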